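{- Testing uniformity requires at least $\Omega(\log\log n)$ non-adaptive conditional samples for some fixed $\epsilon$. That is, there exist constants $\epsilon>0$ and $c>0$ such that for all sufficiently large $n$, every non-adaptive distribution tester for the property of being the uniform distribution over $[n]$, with distance parameter $\epsilon$ and error bound $\delta=\frac13$, must use at least $c\log\log n$ conditional samples.
   Context: $[n]=\{1,\ldots,n\}$; the variation distance is $d(\mu,\mu')=\frac12\sum_{i=1}^n|\mu(i)-\mu'(i)|$. A conditional sampling oracle for a distribution $\mu$ over $[n]$ takes a nonempty set $A\subseteq[n]$ and returns $j\in A$ with probability $\mu(j)/\mu(A)$ if $\mu(A)>0$, and a uniformly random member of $A$ if $\mu(A)=0$, independently of all previous samples. A non-adaptive distribution tester for uniformity (with parameters $\epsilon,\delta,n$) is a randomized algorithm that first generates, before receiving any sample, sets $A_1,\ldots,A_t\subseteq[n]$, then receives $j_1,\ldots,j_t$, where $j_i$ is the oracle's answer on $A_i$, and then accepts or rejects based on $j_1,\ldots,j_t$ and its internal coin tosses. It must accept with probability at least $1-\delta$ if $\mu$ is the uniform distribution over $[n]$, and reject with probability at least $1-\delta$ if $d(\mu,\mu')\ge\epsilon$ for $\mu'$ the uniform distribution over $[n]$. The number of samples it uses is $t$. -}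

module Defs where

open import Level using (Level; suc) renaming (_⊔_ to _⊔ℓ_)
open import Algebra.Apartness.Bundles using (HeytingField)
open import Algebra.Apartness.Structures using (IsHeytingField)
import Algebra.Apartness.Properties.HeytingCommutativeRing as HeytingProperties
open import Algebra.Bundles using (CommutativeRing)
open import Algebra.Core using (Op₁; Op₂)
import Algebra.Properties.Ring as RingProperties
import Algebra.Properties.Semiring.Mult as SemiringMult
import Algebra.Properties.Semiring.Sum as SemiringSum
open import Data.Bool.Base using (Bool; true; false; not; if_then_else_)
open import Data.Empty using (⊥-elim)
open import Data.Fin.Base using (Fin)
open import Data.Fin.Subset using (Subset; Nonempty; _∈_; _∉_; ∣_∣)
open import Data.Fin.Subset.Properties using (x∈p⇒∣p-x∣<∣p∣)
open import Data.Integer.Base using (ℤ; +_; -[1+_])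
open import Data.Nat.Base as ℕ using (ℕ; NonZero; >-nonZero)
import Data.Nat.Properties as ℕ
open import Data.Product.Base using (∃; Σ-syntax; _×_; _,_; proj₁; proj₂)
open import Data.Rational.Base using (ℚ; ↥_; ↧ₙ_)
open import Data.Sum.Base using (_⊎_; inj₁; inj₂)
open import Data.Vec.Base using (Vec; []; _∷_; lookup; map)
open import Relation.Binary.Core using (Rel)
open import Relation.Binary.Lattice.Definitions using (Supremum)
open import Relation.Binary.Structures using (IsStrictPartialOrder)
open import Relation.Nullary.Negation using (¬_)

-- The real numbers enter only through the axioms of an ordered field, in the
-- constructive form (apartness x < y ⊎ y < x, order ≤ given by the negation of
-- the converse of <, binary maxima).  No decidability, Archimedean or
-- completeness axiom is assumed, so the models include ℚ, the Cauchy reals,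
-- the Dedekind reals and, classically, the usual field ℝ.

record OrderedField c ℓ₁ ℓ₂ : Set (suc (c ⊔ℓ ℓ₁ ⊔ℓ ℓ₂)) where
  infix  8 -_
  infixl 7 _*_
  infixl 6 _+_ _∨_
  infix  4 _≈_ _<_ _≤_ _#_
  field
    Carrier : Set c
    _≈_     : Rel Carrier ℓ₁
    _<_     : Rel Carrier ℓ₂
    _+_     : Op₂ Carrier
    _*_     : Op₂ Carrier
    _∨_     : Op₂ Carrier
    -_      : Op₁ Carrier
    0#      : Carrier
    1#      : Carrier

  _#_ : Rel Carrier ℓ₂
  x # y = x < y ⊎ y < x

  _≤_ : Rel Carrier ℓ₂
  x ≤ y = ¬ (y < x)

  field
    <-isStrictPartialOrder : IsStrictPartialOrder _≈_ _<_
    isHeytingField         : IsHeytingField _≈_ _#_ _+_ _*_ -_ 0# 1#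
    +-monoˡ-<              : ∀ {x y} z → x < y → (x + z) < (y + z)
    *-pos                  : ∀ {x y} → 0# < x → 0# < y → 0# < (x * y)
    ∨-supremum             : Supremum _≤_ _∨_

  open IsStrictPartialOrder <-isStrictPartialOrder public
    using (<-resp-≈; <-respˡ-≈; <-respʳ-≈)
    renaming (irrefl to <-irrefl; trans to <-trans)

  heytingField : HeytingField c ℓ₁ ℓ₂
  heytingField = record { isHeytingField = isHeytingField }

  open HeytingField heytingField public
    using (heytingCommutativeRing; isHeytingCommutativeRing; isCommutativeRing;
           #-irrefl; #-sym; #-cotrans; #⇒invertible; invertible⇒#; tight)

  commutativeRing : CommutativeRing c ℓ₁
  commutativeRing = record { isCommutativeRing = isCommutativeRing }

  open CommutativeRing commutativeRing public
    hiding (Carrier; _≈_; _+_; _*_; -_; 0#; 1#; isCommutativeRing)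

  open SemiringSum semiring public
    using (sum; sum-syntax; sum-replicate)

  -- k · x is the k-fold sum x + … + x.
  open SemiringMult semiring public
    using (×-assoc-*)
    renaming (_×_ to _·_)

  ∣_∣ₐ : Op₁ Carrier
  ∣ x ∣ₐ = x ∨ (- x)

  -- The library's field axiom inverts x - 0#, not x itself; ⁻¹-inverseʳ
  -- confirms that this is an inverse of x.
  inv : ∀ x → 0# < x → Carrier
  inv x 0<x = proj₁ (#⇒invertible {x} {0#} (inj₂ 0<x))

  ⁻¹-inverseʳ : ∀ x (0<x : 0# < x) → (x * inv x 0<x) ≈ 1#
  ⁻¹-inverseʳ x 0<x =
    trans (*-congʳ (sym (HeytingProperties.x-0≈x heytingCommutativeRing x)))
          (proj₂ (proj₂ (#⇒invertible {x} {0#} (inj₂ 0<x))))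

  neg-pos : ∀ {x} → x < 0# → 0# < - x
  neg-pos {x} x<0 =
    <-respˡ-≈ (-‿inverseʳ x) (<-respʳ-≈ (+-identityˡ (- x)) (+-monoˡ-< (- x) x<0))

  0<1 : 0# < 1#
  0<1 with HeytingProperties.1#0 heytingCommutativeRing
  ... | inj₂ 0<1′ = 0<1′
  ... | inj₁ 1<0  = <-respʳ-≈ [-1]²≈1 (*-pos (neg-pos 1<0) (neg-pos 1<0))
    where
    open RingProperties ring using (-1*x≈-x; -‿involutive)
    [-1]²≈1 : ((- 1#) * (- 1#)) ≈ 1#
    [-1]²≈1 = trans (-1*x≈-x (- 1#)) (-‿involutive 1#)

  fromℕ : ℕ → Carrier
  fromℕ k = k · 1#

  fromℕ-pos : ∀ k .{{_ : NonZero k}} → 0# < fromℕ k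
  fromℕ-pos 1                   = <-respʳ-≈ (sym (+-identityʳ 1#)) 0<1
  fromℕ-pos (ℕ.suc (ℕ.suc k)) = <-trans (fromℕ-pos (ℕ.suc k))
    (<-respˡ-≈ (+-identityˡ _) (+-monoˡ-< (fromℕ (ℕ.suc k)) 0<1))

  1/_ : ∀ k .{{_ : NonZero k}} → Carrier
  1/ k = inv (fromℕ k) (fromℕ-pos k)

  fromℤ : ℤ → Carrier
  fromℤ (+ k)    = fromℕ k
  fromℤ -[1+ k ] = - fromℕ (ℕ.suc k)

  fromℚ : ℚ → Carrier
  fromℚ q = fromℤ (↥ q) * (1/ (↧ₙ q))

  1/-nonneg : ∀ k .{{_ : NonZero k}} → 0# ≤ (1/ k)
  1/-nonneg k 1/k<0 =
    <-irrefl refl (<-trans 0<1 (<-respʳ-≈ (-‿inverseˡ 1#)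
      (<-respˡ-≈ (+-identityˡ 1#) (+-monoˡ-< 1# 0<-1))))
    where
    open RingProperties ring using (-‿distribʳ-*)
    0<-1 : 0# < - 1#
    0<-1 = <-respʳ-≈
      (trans (sym (-‿distribʳ-* (fromℕ k) (1/ k)))
             (-‿cong (⁻¹-inverseʳ (fromℕ k) (fromℕ-pos k))))
      (*-pos (fromℕ-pos k) (neg-pos 1/k<0))

module UniformityTesting {c ℓ₁ ℓ₂ : Level} (𝔽 : OrderedField c ℓ₁ ℓ₂) where

  open OrderedField 𝔽

  record Distribution (n : ℕ) : Set (c ⊔ℓ ℓ₁ ⊔ℓ ℓ₂) where
    field
      pmf    : Fin n → Carrier
      nonneg : ∀ i → 0# ≤ pmf i
      total  : (∑[ i < n ] pmf i) ≈ 1#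

  open Distribution public

  uniform : ∀ n .{{_ : NonZero n}} → Distribution n
  uniform n = record
    { pmf    = λ _ → 1/ n
    ; nonneg = λ _ → 1/-nonneg n
    ; total  = trans (sum-replicate n)
        (trans (sym (trans (×-assoc-* n 1# (1/ n)) (·-congʳ n (*-identityˡ (1/ n)))))
               (⁻¹-inverseʳ (fromℕ n) (fromℕ-pos n)))
    }
    where open SemiringMult semiring using () renaming (×-congʳ to ·-congʳ)

  variationDistance : ∀ {n} → Distribution n → Distribution n → Carrier
  variationDistance {n} μ μ′ = (1/ 2) * (∑[ i < n ] ∣ pmf μ i - pmf μ′ i ∣ₐ)

  mass : ∀ {n} → Distribution n → Subset n → Carrier
  mass {n} μ A = ∑[ i < n ] (if lookup A i then pmf μ i else 0#)

  Query : ℕ → Set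
  Query n = ∃ (Nonempty {n})

  queryNonZero : ∀ {n} ((A , _) : Query n) → NonZero ∣ A ∣
  queryNonZero (A , _ , x∈A) = >-nonZero (ℕ.≤-<-trans ℕ.z≤n (x∈p⇒∣p-x∣<∣p∣ x∈A))

  -- law A is the distribution of a single answer to the query A.  It is
  -- specified by its values rather than computed by a case split because
  -- 0# < mass μ A need not be decidable.
  record ConditionalOracle {n} (μ : Distribution n) : Set (c ⊔ℓ ℓ₁ ⊔ℓ ℓ₂) where
    field
      law         : Query n → Distribution n
      supported   : ∀ ((A , ne) : Query n) {j} → j ∉ A →
                    pmf (law (A , ne)) j ≈ 0#
      conditional : ∀ ((A , ne) : Query n) {j} → j ∈ A →
                    (0<μA : 0# < mass μ A) →
                    pmf (law (A , ne)) j ≈ (pmf μ j * inv (mass μ A) 0<μA)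
      null        : ∀ ((A , ne) : Query n) {j} → j ∈ A →
                    mass μ A ≈ 0# →
                    pmf (law (A , ne)) j ≈ (1/ ∣ A ∣) {{queryNonZero (A , ne)}}

  open ConditionalOracle public

  -- Expectation under the product distribution: the entries are independent.
  𝔼 : ∀ {n t} → Vec (Distribution n) t → (Vec (Fin n) t → Carrier) → Carrier
  𝔼     []       f = f []
  𝔼 {n} (ρ ∷ ρs) f = ∑[ j < n ] (pmf ρ j * 𝔼 ρs (λ js → f (j ∷ js)))

  -- All the randomness is one draw r from a finite probability space with
  -- arbitrary weights, shared by the choice of the queries and by the decision.
  -- There are finitely many pairs (query tuple, decision rule), so any other
  -- source of coin tosses induces such a space.  Non-adaptivity: queries r does
  -- not depend on the answers.
  record NonAdaptiveTester (n t : ℕ) : Set (c ⊔ℓ ℓ₁ ⊔ℓ ℓ₂) where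
    field
      outcomes : ℕ
      coins    : Distribution outcomes
      queries  : Fin outcomes → Vec (Query n) t
      accepts  : Fin outcomes → Vec (Fin n) t → Bool

  module _ {n t : ℕ} (T : NonAdaptiveTester n t) {μ : Distribution n}
           (O : ConditionalOracle μ) where

    open NonAdaptiveTester T

    private
      probability : (Bool → Bool) → Carrier
      probability event =
        ∑[ r < outcomes ]
          (pmf coins r * 𝔼 (map (law O) (queries r))
                           (λ js → if event (accepts r js) then 1# else 0#))

    Pr[accept] : Carrier
    Pr[accept] = probability (λ b → b)

    Pr[reject] : Carrier
    Pr[reject] = probability not

  record IsUniformityTester {n t} .{{_ : NonZero n}} (ε δ : Carrier)
         (T : NonAdaptiveTester n t) : Set (c ⊔ℓ ℓ₁ ⊔ℓ ℓ₂) where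
    field
      complete : (O : ConditionalOracle (uniform n)) →
                 (1# - δ) ≤ Pr[accept] T O
      sound    : (μ : Distribution n) → ε ≤ variationDistance μ (uniform n) →
                 (O : ConditionalOracle μ) →
                 (1# - δ) ≤ Pr[reject] T O

module Submission where

-- Why few non-adaptive conditional samples cannot test uniformity.
--
-- Hard instances.  Draw S independent uniform points of [n] and let μ be their
-- empirical distribution.  If 2S ≤ n, at least half of [n] has no mass, so μ
-- is at distance at least 1/4 from uniform.  A conditional sample from A is a
-- uniform choice among the points drawn that lie in A, or a uniform element of
-- A if there is none.  Averaged over the draw, a single sample is therefore
-- exactly uniform on A.
--
-- Good scales.  Fix t queries.  Call A big at scale s if s|A| ≥ P n and small
-- if P s|A| ≤ n, where P = 64 q² and t < q.  Suppose that each query is big or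
-- small, and draw S = t + s points.  Then the expected acceptance probability is at
-- least that under the uniform distribution, up to 1/8:
--
--  * The points drawn miss all small queries up to an expected number of hits
--    of at most t S|A|/n, so small queries are answered uniformly.
--
--  * Write N_A for the number of points drawn in A.  For the big queries the
--    probability of answers j_1, j_2, ... is the product of the multiplicities
--    of the j_l divided by Z, the product of the N_A.  Taking out one of the
--    points drawn at j_1, then one at j_2, and so on (`draw-lookup`) leaves at
--    least s fresh points in the expectation, and gives a lower bound C E[1/Z]
--    times the uniform probability of the answers, where C is the product of
--    the expected counts s|A|/n, and where each N_A in Z is raised by at most
--    the number of points taken out (`plant`).
--
--  * The tangent inequality C/Z + Z/C ≥ 2 reduces a lower bound on C E[1/Z] to
--    an upper bound on E[Z], which the same removal of points gives
--    (`draw-sizes-≤`).  As the counts are not assumed to concentrate, no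
--    variance is computed.
--
-- `uniform-≤-draw` combines these three points.
--
-- Averaging.  Let the scale run over R, R², ..., R^K with R = P².  Every query
-- is neither big nor small at one of these scales at most (`Bad-unique`), so a
-- tuple of t queries has at most t scales that are not good.  A tester accepts
-- every hard instance with probability at most 1/3 and the uniform
-- distribution with probability at least 2/3, so averaging over the K scales
-- and the coins gives 2K/3 ≤ K/3 + t + K/8, which is false for K = 8q, t < q
-- (`no-tester`).  The construction needs 4 R^K ≤ n; with q a power of two
-- above t, n ≥ 2^(2^(10 max(t,1))) suffices, and this follows from
-- n ≥ 2^(2^10) and 10 t < log log n.
--
-- All inequalities are proved in an arbitrary ordered field.  Its order is not
-- decidable, but ≤ is a negation, so case distinctions on the order may be
-- made when proving x ≤ y; distinctions on counts are decidable in ℕ.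

open import Defs
import Algebra.Properties.Ring as RingProperties
import Algebra.Properties.Semiring.Exp as SemiringExp
import Algebra.Properties.Semiring.Mult as SemiringMult
import Algebra.Properties.Semiring.Sum as SemiringSum
import Algebra.Solver.Ring.NaturalCoefficients.Default as NaturalSolver
open import Data.Bool.Base using (Bool; true; false; if_then_else_; not)
open import Data.Empty using (⊥; ⊥-elim)
open import Data.Fin.Base as Fin using (Fin)
import Data.Fin.Properties as Fin
open import Data.Fin.Subset using (Subset; ∣_∣; _∈_; _∉_)
open import Data.Integer.Base as ℤ using (+_)
import Data.Integer.Properties as ℤ
open import Data.Nat.Base as ℕ using (ℕ; NonZero)
open import Data.Nat.Logarithm using (⌈log₂_⌉; ⌈log₂⌉-mono-≤; ⌈log₂2^n⌉≡n)
import Data.Nat.Properties as ℕ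
open import Data.Nat.Tactic.RingSolver using (solve-∀)
open import Data.Product.Base using (_×_; _,_; proj₁; proj₂; ∃-syntax)
open import Data.Rational.Base using (_/_)
import Data.Rational.Properties as ℚ
import Data.Rational.Unnormalised.Base as ℚᵘ
import Data.Rational.Unnormalised.Properties as ℚᵘ
open import Data.Sum.Base using (_⊎_; inj₁; inj₂)
open import Data.Vec.Base as Vec using (Vec; []; _∷_; lookup; replicate; updateAt)
open import Data.Vec.Properties using (lookup⇒[]=; []=⇒lookup)
open import Data.Vec.Relation.Unary.All using (All; []; _∷_)
open import Function.Base using (_∘_)
open import Level using (Level)
open import Relation.Binary.Bundles using (Poset)
open import Relation.Binary.Definitions using (tri<; tri≈; tri>)
open import Relation.Binary.PropositionalEquality as ≡ using (_≡_)
open import Relation.Nullary.Decidable.Core using (Dec; yes; no; does; _×-dec_)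
open import Relation.Nullary.Negation using (¬_; contradiction)

-- Ordered fields

module OrderedFieldProperties {c ℓ₁ ℓ₂ : Level} (𝔽 : OrderedField c ℓ₁ ℓ₂) where

  open OrderedField 𝔽 public
  open RingProperties ring public using (-‿distribˡ-*; -‿distribʳ-*; -‿involutive)
  open SemiringSum semiring public
    using (*-distribˡ-sum; *-distribʳ-sum; ∑-distrib-+; ∑-comm; sum-replicate-zero)
    renaming (sum-cong-≋ to sum-cong)
  open SemiringMult semiring public using (×1-homo-*; ×-homo-+)
  open NaturalSolver commutativeSemiring public using (solve; _:+_; _:*_; _:=_; con)

  ≤-trans : ∀ {x y z} → x ≤ y → y ≤ z → x ≤ z
  ≤-trans {x} {y} {z} x≤y y≤z z<x with #-cotrans (inj₁ z<x) y
  ... | inj₁ (inj₁ z<y) = y≤z z<y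
  ... | inj₁ (inj₂ y<z) = x≤y (<-trans y<z z<x)
  ... | inj₂ (inj₁ y<x) = x≤y y<x
  ... | inj₂ (inj₂ x<y) = y≤z (<-trans z<x x<y)

  ≤-antisym : ∀ {x y} → x ≤ y → y ≤ x → x ≈ y
  ≤-antisym {x} {y} x≤y y≤x = proj₁ (tight x y) λ where
    (inj₁ x<y) → y≤x x<y
    (inj₂ y<x) → x≤y y<x

  ≤-reflexive : ∀ {x y} → x ≈ y → x ≤ y
  ≤-reflexive x≈y = <-irrefl (sym x≈y)

  ≤-poset : Poset c ℓ₁ ℓ₂
  ≤-poset = record
    { _≤_ = _≤_
    ; isPartialOrder = record
      { isPreorder = record
        { isEquivalence = isEquivalence
        ; reflexive     = ≤-reflexive
        ; trans         = ≤-trans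
        }
      ; antisym = ≤-antisym
      }
    }

  open Poset ≤-poset public using () renaming (refl to ≤-refl)
  open import Relation.Binary.Reasoning.PartialOrder ≤-poset public
    hiding (step-≡; step-≡-∣)

  <⇒≤ : ∀ {x y} → x < y → x ≤ y
  <⇒≤ x<y y<x = <-irrefl refl (<-trans x<y y<x)

  -- The order is total up to double negation, which suffices to prove
  -- inequalities, ≤ being a negation.
  ≤-cases : ∀ x y {u v} → (x ≤ y → u ≤ v) → (y ≤ x → u ≤ v) → u ≤ v
  ≤-cases x y x≤y⇒ y≤x⇒ v<u = x≤y⇒ (λ y<x → y≤x⇒ (<⇒≤ y<x) v<u) v<u

  +-monoˡ-≤ : ∀ {x y} z → x ≤ y → x + z ≤ y + z
  +-monoˡ-≤ {x} {y} z x≤y y+z<x+z =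
    x≤y (<-respˡ-≈ (cancel y) (<-respʳ-≈ (cancel x) (+-monoˡ-< (- z) y+z<x+z)))
    where
    cancel : ∀ w → (w + z) + - z ≈ w
    cancel w = trans (+-assoc w z (- z))
                 (trans (+-congˡ (-‿inverseʳ z)) (+-identityʳ w))

  +-mono-≤ : ∀ {x y u v} → x ≤ y → u ≤ v → x + u ≤ y + v
  +-mono-≤ {x} {y} {u} {v} x≤y u≤v = begin
    x + u ≤⟨ +-monoˡ-≤ u x≤y ⟩
    y + u ≈⟨ +-comm y u ⟩
    u + y ≤⟨ +-monoˡ-≤ y u≤v ⟩
    v + y ≈⟨ +-comm v y ⟩
    y + v ∎

  +-monoʳ-≤ : ∀ {x y} z → x ≤ y → z + x ≤ z + y
  +-monoʳ-≤ z = +-mono-≤ (≤-refl {z})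

  +-cancelʳ-≤ : ∀ {x y} z → x + z ≤ y + z → x ≤ y
  +-cancelʳ-≤ z x+z≤y+z y<x = x+z≤y+z (+-monoˡ-< z y<x)

  ≤-+ˡ : ∀ {x y} z → 0# ≤ z → x ≤ y → x ≤ z + y
  ≤-+ˡ {x} {y} z 0≤z x≤y = begin
    x      ≈⟨ +-identityˡ x ⟨
    0# + x ≤⟨ +-mono-≤ 0≤z x≤y ⟩
    z + y  ∎

  ≤-+ʳ : ∀ {x y} z → 0# ≤ z → x ≤ y → x ≤ y + z
  ≤-+ʳ z 0≤z x≤y = ≤-trans (≤-+ˡ z 0≤z x≤y) (≤-reflexive (+-comm z _))

  0≤x+y : ∀ {x y} → 0# ≤ x → 0# ≤ y → 0# ≤ x + y
  0≤x+y 0≤x 0≤y = ≤-+ʳ _ 0≤y 0≤x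

  x≤y⇒0≤y-x : ∀ {x y} → x ≤ y → 0# ≤ y - x
  x≤y⇒0≤y-x {x} x≤y = ≤-trans (≤-reflexive (sym (-‿inverseʳ x))) (+-monoˡ-≤ (- x) x≤y)

  y-x+x≈y : ∀ x y → (y - x) + x ≈ y
  y-x+x≈y x y = trans (+-assoc y (- x) x)
                  (trans (+-congˡ (-‿inverseˡ x)) (+-identityʳ y))

  0≤x*y : ∀ {x y} → 0# ≤ x → 0# ≤ y → 0# ≤ x * y
  0≤x*y {x} {y} 0≤x 0≤y xy<0 = ¬0<x λ 0<x → ¬0<y λ 0<y → <⇒≤ (*-pos 0<x 0<y) xy<0
    where
    ¬0<x : ¬ ¬ (0# < x)
    ¬0<x x≤0 = <-irrefl (trans (*-congʳ (≤-antisym x≤0 0≤x)) (zeroˡ y)) xy<0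
    ¬0<y : ¬ ¬ (0# < y)
    ¬0<y y≤0 = <-irrefl (trans (*-congˡ (≤-antisym y≤0 0≤y)) (zeroʳ x)) xy<0

  *-monoʳ-≤ : ∀ {x y} z → 0# ≤ z → x ≤ y → z * x ≤ z * y
  *-monoʳ-≤ {x} {y} z 0≤z x≤y = begin
    z * x                 ≤⟨ ≤-+ˡ _ (0≤x*y 0≤z (x≤y⇒0≤y-x x≤y)) ≤-refl ⟩
    z * (y - x) + z * x   ≈⟨ distribˡ z (y - x) x ⟨
    z * ((y - x) + x)     ≈⟨ *-congˡ (y-x+x≈y x y) ⟩
    z * y                 ∎

  *-monoˡ-≤ : ∀ {x y} z → 0# ≤ z → x ≤ y → x * z ≤ y * z
  *-monoˡ-≤ {x} {y} z 0≤z x≤y = begin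
    x * z ≈⟨ *-comm x z ⟩
    z * x ≤⟨ *-monoʳ-≤ z 0≤z x≤y ⟩
    z * y ≈⟨ *-comm z y ⟩
    y * z ∎

  *-mono-≤ : ∀ {x y u v} → 0# ≤ x → 0# ≤ v → x ≤ y → u ≤ v → x * u ≤ y * v
  *-mono-≤ 0≤x 0≤v x≤y u≤v = ≤-trans (*-monoʳ-≤ _ 0≤x u≤v) (*-monoˡ-≤ _ 0≤v x≤y)

  0≤1 : 0# ≤ 1#
  0≤1 = <⇒≤ 0<1

  0≤x² : ∀ x → 0# ≤ x * x
  0≤x² x = ≤-cases 0# x (λ 0≤x → 0≤x*y 0≤x 0≤x) λ x≤0 → begin
    0#            ≤⟨ 0≤x*y (0≤-x x≤0) (0≤-x x≤0) ⟩
    - x * - x     ≈⟨ -x*-x≈x*x ⟩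
    x * x         ∎
    where
    0≤-x : x ≤ 0# → 0# ≤ - x
    0≤-x x≤0 = ≤-trans (x≤y⇒0≤y-x x≤0) (≤-reflexive (+-identityˡ (- x)))
    -x*-x≈x*x : - x * - x ≈ x * x
    -x*-x≈x*x = trans (sym (-‿distribˡ-* x (- x)))
      (trans (-‿cong (sym (-‿distribʳ-* x x))) (-‿involutive (x * x)))

  2xy≤x²+y² : ∀ x y → x * y + x * y ≤ x * x + y * y
  2xy≤x²+y² x y = begin
    x * y + x * y                        ≈⟨ +-cong (*-congʳ x≈d+y) (*-congʳ x≈d+y) ⟩
    (d + y) * y + (d + y) * y            ≤⟨ ≤-+ˡ _ (0≤x² d) ≤-refl ⟩
    d * d + ((d + y) * y + (d + y) * y)  ≈⟨ solve 2 (λ d y → d :* d :+ ((d :+ y) :* y :+ (d :+ y) :* y)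
                                              := (d :+ y) :* (d :+ y) :+ y :* y) refl d y ⟩
    (d + y) * (d + y) + y * y            ≈⟨ +-congʳ (*-cong x≈d+y x≈d+y) ⟨
    x * x + y * y                        ∎
    where
    d = x - y
    x≈d+y : x ≈ d + y
    x≈d+y = sym (y-x+x≈y y x)

  sum-mono-≤ : ∀ {n} {f g : Fin n → Carrier} → (∀ i → f i ≤ g i) → sum f ≤ sum g
  sum-mono-≤ {ℕ.zero}  f≤g = ≤-refl
  sum-mono-≤ {ℕ.suc n} f≤g = +-mono-≤ (f≤g Fin.zero) (sum-mono-≤ (f≤g ∘ Fin.suc))

  sum-nonneg : ∀ {n} {f : Fin n → Carrier} → (∀ i → 0# ≤ f i) → 0# ≤ sum f
  sum-nonneg {n} 0≤f = ≤-trans (≤-reflexive (sym (sum-replicate-zero n))) (sum-mono-≤ 0≤f)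

  fromℕ-+ : ∀ j k → fromℕ (j ℕ.+ k) ≈ fromℕ j + fromℕ k
  fromℕ-+ = ×-homo-+ 1#

  fromℕ-* : ∀ j k → fromℕ (j ℕ.* k) ≈ fromℕ j * fromℕ k
  fromℕ-* = ×1-homo-*

  fromℕ-1 : fromℕ 1 ≈ 1#
  fromℕ-1 = +-identityʳ 1#

  fromℕ-nonneg : ∀ k → 0# ≤ fromℕ k
  fromℕ-nonneg ℕ.zero    = ≤-refl
  fromℕ-nonneg (ℕ.suc k) = 0≤x+y 0≤1 (fromℕ-nonneg k)

  fromℕ-mono-≤ : ∀ {j k} → j ℕ.≤ k → fromℕ j ≤ fromℕ k
  fromℕ-mono-≤ {k = k} ℕ.z≤n = fromℕ-nonneg k
  fromℕ-mono-≤ (ℕ.s≤s j≤k)   = +-monoʳ-≤ 1# (fromℕ-mono-≤ j≤k)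

  fromℕ-cancel-≤ : ∀ {j k} → fromℕ j ≤ fromℕ k → j ℕ.≤ k
  fromℕ-cancel-≤ {ℕ.zero}            _   = ℕ.z≤n
  fromℕ-cancel-≤ {ℕ.suc j} {ℕ.zero}  j≤k = contradiction (fromℕ-pos (ℕ.suc j)) j≤k
  fromℕ-cancel-≤ {ℕ.suc j} {ℕ.suc k} j≤k = ℕ.s≤s (fromℕ-cancel-≤ (+-cancelʳ-≤ 1#
    (≤-trans (≤-reflexive (+-comm _ 1#)) (≤-trans j≤k (≤-reflexive (+-comm 1# _))))))

  1/-inverseˡ : ∀ k .{{_ : NonZero k}} → (1/ k) * fromℕ k ≈ 1#
  1/-inverseˡ k = trans (*-comm _ _) (⁻¹-inverseʳ (fromℕ k) (fromℕ-pos k))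

  -- Reciprocals of natural numbers, with the reciprocal of zero equal to zero.
  recip : ℕ → Carrier
  recip ℕ.zero    = 0#
  recip (ℕ.suc k) = 1/ (ℕ.suc k)

  recip-nonneg : ∀ k → 0# ≤ recip k
  recip-nonneg ℕ.zero    = ≤-refl
  recip-nonneg (ℕ.suc k) = 1/-nonneg (ℕ.suc k)

  recip-inverseˡ : ∀ k .{{_ : NonZero k}} → recip k * fromℕ k ≈ 1#
  recip-inverseˡ (ℕ.suc k) = 1/-inverseˡ (ℕ.suc k)

  recip-antitone : ∀ {j k} .{{_ : NonZero j}} → j ℕ.≤ k → recip k ≤ recip j
  recip-antitone {j} {k} j≤k = begin
    recip k                          ≈⟨ *-identityʳ _ ⟨
    recip k * 1#                     ≈⟨ *-congˡ (recip-inverseˡ j) ⟨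
    recip k * (recip j * fromℕ j)    ≤⟨ *-monoʳ-≤ _ (recip-nonneg k) (*-monoʳ-≤ _ (recip-nonneg j) (fromℕ-mono-≤ j≤k)) ⟩
    recip k * (recip j * fromℕ k)    ≈⟨ solve 3 (λ a b c → a :* (b :* c) := b :* (a :* c)) refl _ _ _ ⟩
    recip j * (recip k * fromℕ k)    ≈⟨ *-congˡ (recip-inverseˡ k {{ℕ.>-nonZero (ℕ.<-≤-trans (ℕ.>-nonZero⁻¹ j) j≤k)}}) ⟩
    recip j * 1#                     ≈⟨ *-identityʳ _ ⟩
    recip j                          ∎

  sum-const : ∀ n x → (∑[ i < n ] x) ≈ fromℕ n * x
  sum-const ℕ.zero    x = sym (zeroˡ x)
  sum-const (ℕ.suc n) x = begin-equality
    x + (∑[ i < n ] x)          ≈⟨ +-cong (*-identityˡ x) (sym (sum-const n x)) ⟨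
    1# * x + fromℕ n * x        ≈⟨ distribʳ x 1# (fromℕ n) ⟨
    fromℕ (ℕ.suc n) * x         ∎

-- Multisets of random points

-- A multiset of points of [n] is encoded by its vector of multiplicities;
-- bump x adds one copy of the point x.
bump : ∀ {n} → Fin n → Vec ℕ n → Vec ℕ n
bump x h = updateAt h x ℕ.suc

-- The number of points of a multiset in a set, with multiplicity.
count : ∀ {n} → Subset n → Vec ℕ n → ℕ
count []          []      = 0
count (true  ∷ A) (k ∷ h) = k ℕ.+ count A h
count (false ∷ A) (k ∷ h) = count A h

-- The multiset in which every point occurs once; counting it gives
-- cardinalities.
ones : ∀ {n} → Vec ℕ n
ones {n} = replicate n 1

bump-comm : ∀ {n} (x y : Fin n) h → bump x (bump y h) ≡ bump y (bump x h)
bump-comm Fin.zero    Fin.zero    (k ∷ h) = ≡.refl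
bump-comm Fin.zero    (Fin.suc y) (k ∷ h) = ≡.refl
bump-comm (Fin.suc x) Fin.zero    (k ∷ h) = ≡.refl
bump-comm (Fin.suc x) (Fin.suc y) (k ∷ h) = ≡.cong (k ∷_) (bump-comm x y h)

sum-bump : ∀ {n} (x : Fin n) h → Vec.sum (bump x h) ≡ ℕ.suc (Vec.sum h)
sum-bump Fin.zero    (k ∷ h) = ≡.refl
sum-bump (Fin.suc x) (k ∷ h) =
  ≡.trans (≡.cong (k ℕ.+_) (sum-bump x h)) (ℕ.+-suc k (Vec.sum h))

sum-zeros : ∀ n → Vec.sum (replicate n 0) ≡ 0
sum-zeros ℕ.zero    = ≡.refl
sum-zeros (ℕ.suc n) = sum-zeros n

lookup-zeros : ∀ {n} (x : Fin n) → lookup (replicate n 0) x ≡ 0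
lookup-zeros Fin.zero    = ≡.refl
lookup-zeros (Fin.suc x) = lookup-zeros x

lookup-ones : ∀ {n} (x : Fin n) → lookup ones x ≡ 1
lookup-ones Fin.zero    = ≡.refl
lookup-ones (Fin.suc x) = lookup-ones x

lookup-bump-≤ : ∀ {n} (x y : Fin n) h → lookup h x ℕ.≤ lookup (bump y h) x
lookup-bump-≤ Fin.zero    Fin.zero    (k ∷ h) = ℕ.n≤1+n k
lookup-bump-≤ Fin.zero    (Fin.suc y) (k ∷ h) = ℕ.≤-refl
lookup-bump-≤ (Fin.suc x) Fin.zero    (k ∷ h) = ℕ.≤-refl
lookup-bump-≤ (Fin.suc x) (Fin.suc y) (k ∷ h) = lookup-bump-≤ x y h

count-bump-≤ : ∀ {n} (A : Subset n) x h → count A (bump x h) ℕ.≤ ℕ.suc (count A h)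
count-bump-≤ (true  ∷ A) Fin.zero    (k ∷ h) = ℕ.≤-refl
count-bump-≤ (false ∷ A) Fin.zero    (k ∷ h) = ℕ.n≤1+n _
count-bump-≤ (true  ∷ A) (Fin.suc x) (k ∷ h) =
  ℕ.≤-trans (ℕ.+-monoʳ-≤ k (count-bump-≤ A x h)) (ℕ.≤-reflexive (ℕ.+-suc k _))
count-bump-≤ (false ∷ A) (Fin.suc x) (k ∷ h) = count-bump-≤ A x h

count-≤-bump : ∀ {n} (A : Subset n) x h → count A h ℕ.≤ count A (bump x h)
count-≤-bump (true  ∷ A) Fin.zero    (k ∷ h) = ℕ.n≤1+n _
count-≤-bump (false ∷ A) Fin.zero    (k ∷ h) = ℕ.≤-refl
count-≤-bump (true  ∷ A) (Fin.suc x) (k ∷ h) = ℕ.+-monoʳ-≤ k (count-≤-bump A x h)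
count-≤-bump (false ∷ A) (Fin.suc x) (k ∷ h) = count-≤-bump A x h

count-zeros : ∀ {n} (A : Subset n) → count A (replicate n 0) ≡ 0
count-zeros []          = ≡.refl
count-zeros (true  ∷ A) = count-zeros A
count-zeros (false ∷ A) = count-zeros A

count-ones : ∀ {n} (A : Subset n) → count A ones ≡ ∣ A ∣
count-ones []          = ≡.refl
count-ones (true  ∷ A) = ≡.cong ℕ.suc (count-ones A)
count-ones (false ∷ A) = count-ones A

count≡0⇒lookup≡0 : ∀ {n} (A : Subset n) h {x} → count A h ≡ 0 → lookup A x ≡ true →
                   lookup h x ≡ 0
count≡0⇒lookup≡0 (true  ∷ A) (k ∷ h) {Fin.zero}  eq _   = ℕ.m+n≡0⇒m≡0 k eq
count≡0⇒lookup≡0 (true  ∷ A) (k ∷ h) {Fin.suc x} eq x∈A =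
  count≡0⇒lookup≡0 A h (ℕ.m+n≡0⇒n≡0 k eq) x∈A
count≡0⇒lookup≡0 (false ∷ A) (k ∷ h) {Fin.suc x} eq x∈A = count≡0⇒lookup≡0 A h eq x∈A

module Draws {c ℓ₁ ℓ₂ : Level} (𝔽 : OrderedField c ℓ₁ ℓ₂) (n : ℕ) .{{n≢0 : NonZero n}} where

  open OrderedFieldProperties 𝔽

  -- The indicator function of a set.
  χ : Subset n → Fin n → Carrier
  χ A j = if lookup A j then 1# else 0#

  -- draw s g is the expectation of g at the multiset of s independent uniform
  -- points of [n].
  draw : ℕ → (Vec ℕ n → Carrier) → Carrier
  draw ℕ.zero    g = g (replicate n 0)
  draw (ℕ.suc s) g = ∑[ x < n ] ((1/ n) * draw s (g ∘ bump x))

  average-const : ∀ v → (∑[ x < n ] ((1/ n) * v)) ≈ v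
  average-const v = begin-equality
    (∑[ x < n ] ((1/ n) * v))  ≈⟨ sum-const n ((1/ n) * v) ⟩
    fromℕ n * ((1/ n) * v)     ≈⟨ *-assoc _ _ _ ⟨
    fromℕ n * (1/ n) * v       ≈⟨ *-congʳ (⁻¹-inverseʳ (fromℕ n) (fromℕ-pos n)) ⟩
    1# * v                     ≈⟨ *-identityˡ v ⟩
    v                          ∎

  draw-cong : ∀ s {f g} → (∀ h → f h ≈ g h) → draw s f ≈ draw s g
  draw-cong ℕ.zero    f≈g = f≈g _
  draw-cong (ℕ.suc s) f≈g = sum-cong λ x → *-congˡ (draw-cong s (f≈g ∘ bump x))

  draw-mono-on : ∀ s {f g} → (∀ h → Vec.sum h ≡ s → f h ≤ g h) → draw s f ≤ draw s g
  draw-mono-on ℕ.zero    f≤g = f≤g _ (sum-zeros n)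
  draw-mono-on (ℕ.suc s) f≤g = sum-mono-≤ λ x → *-monoʳ-≤ _ (1/-nonneg n)
    (draw-mono-on s λ h eq → f≤g (bump x h) (≡.trans (sum-bump x h) (≡.cong ℕ.suc eq)))

  draw-mono : ∀ s {f g} → (∀ h → f h ≤ g h) → draw s f ≤ draw s g
  draw-mono s f≤g = draw-mono-on s λ h _ → f≤g h

  draw-const : ∀ s v → draw s (λ _ → v) ≈ v
  draw-const ℕ.zero    v = refl
  draw-const (ℕ.suc s) v =
    trans (sum-cong {n} λ _ → *-congˡ (draw-const s v)) (average-const v)

  draw-nonneg : ∀ s {g} → (∀ h → 0# ≤ g h) → 0# ≤ draw s g
  draw-nonneg s 0≤g = ≤-trans (≤-reflexive (sym (draw-const s 0#))) (draw-mono s 0≤g)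

  draw-+ : ∀ s f g → draw s (λ h → f h + g h) ≈ draw s f + draw s g
  draw-+ ℕ.zero    f g = refl
  draw-+ (ℕ.suc s) f g = begin-equality
    (∑[ x < n ] ((1/ n) * draw s (λ h → f (bump x h) + g (bump x h))))
      ≈⟨ sum-cong {n} (λ x → trans (*-congˡ (draw-+ s (f ∘ bump x) (g ∘ bump x))) (distribˡ _ _ _)) ⟩
    (∑[ x < n ] ((1/ n) * draw s (f ∘ bump x) + (1/ n) * draw s (g ∘ bump x)))
      ≈⟨ ∑-distrib-+ {n} (λ x → (1/ n) * draw s (f ∘ bump x)) (λ x → (1/ n) * draw s (g ∘ bump x)) ⟩
    draw (ℕ.suc s) f + draw (ℕ.suc s) g ∎

  draw-* : ∀ s v f → draw s (λ h → v * f h) ≈ v * draw s f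
  draw-* ℕ.zero    v f = refl
  draw-* (ℕ.suc s) v f = begin-equality
    (∑[ x < n ] ((1/ n) * draw s (λ h → v * f (bump x h))))
      ≈⟨ sum-cong {n} (λ x → trans (*-congˡ (draw-* s v (f ∘ bump x)))
                         (solve 3 (λ a b c → a :* (b :* c) := b :* (a :* c)) refl _ _ _)) ⟩
    (∑[ x < n ] (v * ((1/ n) * draw s (f ∘ bump x))))
      ≈⟨ *-distribˡ-sum v (λ x → (1/ n) * draw s (f ∘ bump x)) ⟨
    v * draw (ℕ.suc s) f ∎

  draw-∑ : ∀ s {m} (f : Fin m → Vec ℕ n → Carrier) →
           draw s (λ h → ∑[ j < m ] f j h) ≈ ∑[ j < m ] draw s (f j)
  draw-∑ s {ℕ.zero}  f = draw-const s 0#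
  draw-∑ s {ℕ.suc m} f = trans (draw-+ s _ _) (+-congˡ (draw-∑ s (f ∘ Fin.suc)))

  -- An additional point may be dropped from an expectation.
  draw-suc-≥ : ∀ s {f g} → (∀ x h → f h ≤ g (bump x h)) → draw s f ≤ draw (ℕ.suc s) g
  draw-suc-≥ s {f} {g} f≤g = begin
    draw s f                                       ≈⟨ average-const (draw s f) ⟨
    (∑[ x < n ] ((1/ n) * draw s f))               ≤⟨ sum-mono-≤ {n} (λ x → *-monoʳ-≤ _ (1/-nonneg n) (draw-mono s (f≤g x))) ⟩
    (∑[ x < n ] ((1/ n) * draw s (g ∘ bump x)))    ∎

  private
    -- Kronecker's delta.
    δ : ∀ {m} → Fin m → Fin m → Carrier
    δ Fin.zero    Fin.zero    = 1#
    δ Fin.zero    (Fin.suc y) = 0#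
    δ (Fin.suc x) Fin.zero    = 0#
    δ (Fin.suc x) (Fin.suc y) = δ x y

    lookup-bump : ∀ {m} (y x : Fin m) h →
                  fromℕ (lookup (bump y h) x) ≈ δ y x + fromℕ (lookup h x)
    lookup-bump Fin.zero    Fin.zero    (k ∷ h) = refl
    lookup-bump Fin.zero    (Fin.suc x) (k ∷ h) = sym (+-identityˡ _)
    lookup-bump (Fin.suc y) Fin.zero    (k ∷ h) = sym (+-identityˡ _)
    lookup-bump (Fin.suc y) (Fin.suc x) (k ∷ h) = lookup-bump y x h

    ∑-δ : ∀ {m} (x : Fin m) (f : Fin m → Carrier) → (∑[ y < m ] (δ y x * f y)) ≈ f x
    ∑-δ {ℕ.suc m} Fin.zero f = begin-equality
      1# * f Fin.zero + (∑[ y < m ] (0# * f (Fin.suc y)))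
        ≈⟨ +-cong (*-identityˡ _) (sum-cong {m} λ y → zeroˡ _) ⟩
      f Fin.zero + (∑[ y < m ] 0#)
        ≈⟨ +-congˡ (sum-replicate-zero m) ⟩
      f Fin.zero + 0#
        ≈⟨ +-identityʳ _ ⟩
      f Fin.zero ∎
    ∑-δ {ℕ.suc m} (Fin.suc x) f =
      trans (+-cong (zeroˡ _) (∑-δ x (f ∘ Fin.suc))) (+-identityˡ _)

  -- Removing a point: weighting by the multiplicity of x amounts to choosing
  -- which of the s + 1 points is at x and drawing the other s points afresh.
  draw-lookup : ∀ s x g →
    draw (ℕ.suc s) (λ h → fromℕ (lookup h x) * g h) ≈
    fromℕ (ℕ.suc s) * ((1/ n) * draw s (g ∘ bump x))
  draw-lookup s x g = begin-equality
    (∑[ y < n ] ((1/ n) * draw s (λ h → fromℕ (lookup (bump y h) x) * g (bump y h))))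
      ≈⟨ sum-cong {n} (λ y → *-congˡ (split y)) ⟩
    (∑[ y < n ] ((1/ n) * (δ y x * G y + draw s (λ h → fromℕ (lookup h x) * g (bump y h)))))
      ≈⟨ sum-cong {n} (λ y → solve 4 (λ a d b e → a :* (d :* b :+ e) := d :* (a :* b) :+ a :* e) refl _ _ _ _) ⟩
    (∑[ y < n ] (δ y x * ((1/ n) * G y) + (1/ n) * draw s (λ h → fromℕ (lookup h x) * g (bump y h))))
      ≈⟨ ∑-distrib-+ {n} (λ y → δ y x * ((1/ n) * G y))
           (λ y → (1/ n) * draw s (λ h → fromℕ (lookup h x) * g (bump y h))) ⟩
    (∑[ y < n ] (δ y x * ((1/ n) * G y))) + (∑[ y < n ] ((1/ n) * draw s (λ h → fromℕ (lookup h x) * g (bump y h))))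
      ≈⟨ +-cong (∑-δ x (λ y → (1/ n) * G y)) (remaining s) ⟩
    (1/ n) * G x + fromℕ s * ((1/ n) * G x)
      ≈⟨ solve 2 (λ u v → u :+ v :* u := (con 1 :+ v) :* u) refl _ _ ⟩
    fromℕ (ℕ.suc s) * ((1/ n) * G x) ∎
    where
    G : Fin n → Carrier
    G y = draw s (g ∘ bump y)

    split : ∀ y → draw s (λ h → fromℕ (lookup (bump y h) x) * g (bump y h)) ≈
                  δ y x * G y + draw s (λ h → fromℕ (lookup h x) * g (bump y h))
    split y = begin-equality
      draw s (λ h → fromℕ (lookup (bump y h) x) * g (bump y h))
        ≈⟨ draw-cong s (λ h → trans (*-congʳ (lookup-bump y x h)) (distribʳ _ _ _)) ⟩
      draw s (λ h → δ y x * g (bump y h) + fromℕ (lookup h x) * g (bump y h))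
        ≈⟨ draw-+ s _ _ ⟩
      draw s (λ h → δ y x * g (bump y h)) + draw s (λ h → fromℕ (lookup h x) * g (bump y h))
        ≈⟨ +-congʳ (draw-* s (δ y x) (g ∘ bump y)) ⟩
      δ y x * G y + draw s (λ h → fromℕ (lookup h x) * g (bump y h)) ∎

    -- The multiplicity of x among the points other than the last one.
    remaining : ∀ s → (∑[ y < n ] ((1/ n) * draw s (λ h → fromℕ (lookup h x) * g (bump y h)))) ≈
                fromℕ s * ((1/ n) * draw s (g ∘ bump x))
    remaining ℕ.zero = begin-equality
      (∑[ y < n ] ((1/ n) * (fromℕ (lookup (replicate n 0) x) * g (bump y (replicate n 0)))))
        ≈⟨ sum-cong {n} (λ y → trans (*-congˡ (trans (*-congʳ (reflexive (≡.cong fromℕ (lookup-zeros x)))) (zeroˡ _))) (zeroʳ _)) ⟩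
      (∑[ y < n ] 0#)                          ≈⟨ sum-replicate-zero n ⟩
      0#                                       ≈⟨ zeroˡ _ ⟨
      0# * ((1/ n) * g (bump x (replicate n 0)))   ∎
    remaining (ℕ.suc s) = begin-equality
      (∑[ y < n ] ((1/ n) * draw (ℕ.suc s) (λ h → fromℕ (lookup h x) * g (bump y h))))
        ≈⟨ sum-cong {n} (λ y → *-congˡ (draw-lookup s x (g ∘ bump y))) ⟩
      (∑[ y < n ] ((1/ n) * (fromℕ (ℕ.suc s) * ((1/ n) * draw s (λ h → g (bump y (bump x h)))))))
        ≈⟨ sum-cong {n} (λ y → solve 3 (λ a b c → a :* (b :* (a :* c)) := b :* a :* (a :* c)) refl _ _ _) ⟩
      (∑[ y < n ] (fromℕ (ℕ.suc s) * (1/ n) * ((1/ n) * draw s (λ h → g (bump y (bump x h))))))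
        ≈⟨ *-distribˡ-sum _ (λ y → (1/ n) * draw s (λ h → g (bump y (bump x h)))) ⟨
      fromℕ (ℕ.suc s) * (1/ n) * (∑[ y < n ] ((1/ n) * draw s (λ h → g (bump y (bump x h)))))
        ≈⟨ *-congˡ (sum-cong {n} (λ y → *-congˡ (draw-cong s λ h → reflexive (≡.cong g (bump-comm y x h))))) ⟩
      fromℕ (ℕ.suc s) * (1/ n) * draw (ℕ.suc s) (g ∘ bump x)
        ≈⟨ *-assoc _ _ _ ⟩
      fromℕ (ℕ.suc s) * ((1/ n) * draw (ℕ.suc s) (g ∘ bump x)) ∎

  fromℕ-count : ∀ A (h : Vec ℕ n) → fromℕ (count A h) ≈ ∑[ j < n ] (χ A j * fromℕ (lookup h j))
  fromℕ-count A h = go A h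
    where
    go : ∀ {m} (A : Subset m) h →
         fromℕ (count A h) ≈ ∑[ j < m ] ((if lookup A j then 1# else 0#) * fromℕ (lookup h j))
    go []          []      = refl
    go (true  ∷ A) (k ∷ h) =
      trans (fromℕ-+ k (count A h)) (+-cong (sym (*-identityˡ _)) (go A h))
    go (false ∷ A) (k ∷ h) =
      trans (go A h) (sym (trans (+-congʳ (zeroˡ _)) (+-identityˡ _)))

  χ-nonneg : ∀ A j → 0# ≤ χ A j
  χ-nonneg A j with lookup A j
  ... | true  = 0≤1
  ... | false = ≤-refl

  ∑-χ : ∀ A → (∑[ j < n ] χ A j) ≈ fromℕ (count A ones)
  ∑-χ A = sym (trans (fromℕ-count A ones) (sum-cong {n} λ j →
    trans (*-congˡ (trans (reflexive (≡.cong fromℕ (lookup-ones j))) fromℕ-1)) (*-identityʳ _)))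

  draw-count : ∀ s A g →
    draw (ℕ.suc s) (λ h → fromℕ (count A h) * g h) ≈
    ∑[ j < n ] (χ A j * (fromℕ (ℕ.suc s) * ((1/ n) * draw s (g ∘ bump j))))
  draw-count s A g = begin-equality
    draw (ℕ.suc s) (λ h → fromℕ (count A h) * g h)
      ≈⟨ draw-cong (ℕ.suc s) expand ⟩
    draw (ℕ.suc s) (λ h → ∑[ j < n ] (χ A j * (fromℕ (lookup h j) * g h)))
      ≈⟨ draw-∑ (ℕ.suc s) (λ j h → χ A j * (fromℕ (lookup h j) * g h)) ⟩
    (∑[ j < n ] draw (ℕ.suc s) (λ h → χ A j * (fromℕ (lookup h j) * g h)))
      ≈⟨ sum-cong {n} (λ j → trans (draw-* (ℕ.suc s) (χ A j) (λ h → fromℕ (lookup h j) * g h)) (*-congˡ (draw-lookup s j g))) ⟩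
    (∑[ j < n ] (χ A j * (fromℕ (ℕ.suc s) * ((1/ n) * draw s (g ∘ bump j))))) ∎
    where
    expand : ∀ h → fromℕ (count A h) * g h ≈ ∑[ j < n ] (χ A j * (fromℕ (lookup h j) * g h))
    expand h = begin-equality
      fromℕ (count A h) * g h
        ≈⟨ *-congʳ (fromℕ-count A h) ⟩
      (∑[ j < n ] (χ A j * fromℕ (lookup h j))) * g h
        ≈⟨ *-distribʳ-sum (g h) (λ j → χ A j * fromℕ (lookup h j)) ⟩
      (∑[ j < n ] (χ A j * fromℕ (lookup h j) * g h))
        ≈⟨ sum-cong {n} (λ j → *-assoc _ _ _) ⟩
      (∑[ j < n ] (χ A j * (fromℕ (lookup h j) * g h))) ∎

  -- The expected number of s uniform points that lie in A.
  density : ℕ → Subset n → Carrier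
  density s A = fromℕ s * (fromℕ (count A ones) * (1/ n))

  -- The number of points in A and a weight f decouple if f is replaced by a
  -- monotone g that absorbs the effect on f of the point removed.
  draw-count-≤ : ∀ s A {f g : Vec ℕ n → Carrier} → (∀ h → 0# ≤ g h) → (∀ x h → f (bump x h) ≤ g h) →
                 (∀ x h → g h ≤ g (bump x h)) →
                 draw s (λ h → fromℕ (count A h) * f h) ≤ density s A * draw s g
  draw-count-≤ ℕ.zero A {f} {g} 0≤g f≤g g-mono = ≤-reflexive (begin-equality
    fromℕ (count A (replicate n 0)) * f (replicate n 0) ≈⟨ *-congʳ (reflexive (≡.cong fromℕ (count-zeros A))) ⟩
    0# * f (replicate n 0)                              ≈⟨ zeroˡ _ ⟩
    0#                                                  ≈⟨ trans (*-congʳ (zeroˡ _)) (zeroˡ _) ⟨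
    density 0 A * g (replicate n 0)                     ∎)
  draw-count-≤ (ℕ.suc s) A {f} {g} 0≤g f≤g g-mono = begin
    draw (ℕ.suc s) (λ h → fromℕ (count A h) * f h)
      ≈⟨ draw-count s A f ⟩
    (∑[ j < n ] (χ A j * (fromℕ (ℕ.suc s) * ((1/ n) * draw s (f ∘ bump j)))))
      ≤⟨ sum-mono-≤ {n} (λ j → *-monoʳ-≤ _ (χ-nonneg A j) (*-monoʳ-≤ _ (fromℕ-nonneg (ℕ.suc s))
           (*-monoʳ-≤ _ (1/-nonneg n) (≤-trans (draw-mono s (f≤g j)) (draw-suc-≥ s {g} {g} g-mono))))) ⟩
    (∑[ j < n ] (χ A j * (fromℕ (ℕ.suc s) * ((1/ n) * draw (ℕ.suc s) g))))
      ≈⟨ *-distribʳ-sum _ (χ A) ⟨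
    (∑[ j < n ] χ A j) * (fromℕ (ℕ.suc s) * ((1/ n) * draw (ℕ.suc s) g))
      ≈⟨ *-congʳ (∑-χ A) ⟩
    fromℕ (count A ones) * (fromℕ (ℕ.suc s) * ((1/ n) * draw (ℕ.suc s) g))
      ≈⟨ solve 4 (λ a b c d → a :* (b :* (c :* d)) := b :* (a :* c) :* d) refl _ _ _ _ ⟩
    density (ℕ.suc s) A * draw (ℕ.suc s) g ∎

-- Answers to conditional queries

module Expectations {c ℓ₁ ℓ₂ : Level} (𝔽 : OrderedField c ℓ₁ ℓ₂) where

  open OrderedFieldProperties 𝔽
  open UniformityTesting 𝔽

  module _ {n : ℕ} (ρ : Distribution n) where

    mean-mono : ∀ {f g : Fin n → Carrier} → (∀ j → f j ≤ g j) →
                (∑[ j < n ] (pmf ρ j * f j)) ≤ (∑[ j < n ] (pmf ρ j * g j))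
    mean-mono f≤g = sum-mono-≤ {n} λ j → *-monoʳ-≤ _ (nonneg ρ j) (f≤g j)

    mean-const : ∀ v → (∑[ j < n ] (pmf ρ j * v)) ≈ v
    mean-const v = trans (sym (*-distribʳ-sum v (pmf ρ)))
                     (trans (*-congʳ (total ρ)) (*-identityˡ v))

    mean-+ : ∀ (f g : Fin n → Carrier) → (∑[ j < n ] (pmf ρ j * (f j + g j))) ≈
             (∑[ j < n ] (pmf ρ j * f j)) + (∑[ j < n ] (pmf ρ j * g j))
    mean-+ f g = trans (sum-cong {n} λ j → distribˡ _ _ _)
                       (∑-distrib-+ {n} (λ j → pmf ρ j * f j) (λ j → pmf ρ j * g j))

  𝔼-mono : ∀ {n t} (ρs : Vec (Distribution n) t) {f g : Vec (Fin n) t → Carrier} →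
           (∀ js → f js ≤ g js) → 𝔼 ρs f ≤ 𝔼 ρs g
  𝔼-mono []       f≤g = f≤g []
  𝔼-mono (ρ ∷ ρs) f≤g = mean-mono ρ λ j → 𝔼-mono ρs (λ js → f≤g (j ∷ js))

  𝔼-cong : ∀ {n t} (ρs : Vec (Distribution n) t) {f g : Vec (Fin n) t → Carrier} →
           (∀ js → f js ≈ g js) → 𝔼 ρs f ≈ 𝔼 ρs g
  𝔼-cong     []       f≈g = f≈g []
  𝔼-cong {n} (ρ ∷ ρs) f≈g = sum-cong {n} λ j → *-congˡ (𝔼-cong ρs (λ js → f≈g (j ∷ js)))

  𝔼-const : ∀ {n t} (ρs : Vec (Distribution n) t) v → 𝔼 ρs (λ _ → v) ≈ v
  𝔼-const []       v = refl
  𝔼-const {n} (ρ ∷ ρs) v = trans (sum-cong {n} λ j → *-congˡ (𝔼-const ρs v)) (mean-const ρ v)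

  𝔼-+ : ∀ {n t} (ρs : Vec (Distribution n) t) (f g : Vec (Fin n) t → Carrier) →
        𝔼 ρs (λ js → f js + g js) ≈ 𝔼 ρs f + 𝔼 ρs g
  𝔼-+ []       f g = refl
  𝔼-+ {n} (ρ ∷ ρs) f g = trans (sum-cong {n} λ j → *-congˡ (𝔼-+ ρs (λ js → f (j ∷ js)) (λ js → g (j ∷ js))))
    (mean-+ ρ (λ j → 𝔼 ρs (λ js → f (j ∷ js))) (λ j → 𝔼 ρs (λ js → g (j ∷ js))))

  𝔼-nonneg : ∀ {n t} (ρs : Vec (Distribution n) t) {f : Vec (Fin n) t → Carrier} →
             (∀ js → 0# ≤ f js) → 0# ≤ 𝔼 ρs f
  𝔼-nonneg ρs 0≤f = ≤-trans (≤-reflexive (sym (𝔼-const ρs 0#))) (𝔼-mono ρs 0≤f)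

module ConditionalLaws {c ℓ₁ ℓ₂ : Level} (𝔽 : OrderedField c ℓ₁ ℓ₂) (n : ℕ) .{{n≢0 : NonZero n}} where

  open OrderedFieldProperties 𝔽
  open UniformityTesting 𝔽
  open Draws 𝔽 n
  open Expectations 𝔽

  instance
    count-ones-nonZero : ∀ {Q : Query n} → NonZero (count (proj₁ Q) ones)
    count-ones-nonZero {Q} = ≡.subst NonZero (≡.sym (count-ones (proj₁ Q))) (queryNonZero Q)

  -- The multiset from which the query A is answered: h itself if it has a point
  -- in A, and otherwise each point once, which makes the answer uniform on A.
  effective : Subset n → Vec ℕ n → Vec ℕ n
  effective A h with count A h
  ... | ℕ.zero  = ones
  ... | ℕ.suc _ = h

  effective-empty : ∀ A h → count A h ≡ 0 → effective A h ≡ ones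
  effective-empty A h eq with count A h
  effective-empty A h ≡.refl | ℕ.zero = ≡.refl

  effective-nonempty : ∀ A h .{{_ : NonZero (count A h)}} → effective A h ≡ h
  effective-nonempty A h with count A h
  ... | ℕ.suc _ = ≡.refl

  count-effective-nonZero : ∀ (Q : Query n) h → NonZero (count (proj₁ Q) (effective (proj₁ Q) h))
  count-effective-nonZero Q h with count (proj₁ Q) h in eq
  ... | ℕ.zero  = count-ones-nonZero {Q}
  ... | ℕ.suc _ = ≡.subst NonZero (≡.sym eq) _

  -- A uniform choice among the points of h in A.
  restrict : (Q : Query n) (h : Vec ℕ n) → NonZero (count (proj₁ Q) h) → Distribution n
  restrict (A , _) h count≢0 = record
    { pmf    = λ j → χ A j * (fromℕ (lookup h j) * recip (count A h))
    ; nonneg = λ j → 0≤x*y (χ-nonneg A j) (0≤x*y (fromℕ-nonneg (lookup h j)) (recip-nonneg (count A h)))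
    ; total  = begin-equality
        (∑[ j < n ] (χ A j * (fromℕ (lookup h j) * recip (count A h))))
          ≈⟨ sum-cong {n} (λ j → *-assoc _ _ _) ⟨
        (∑[ j < n ] (χ A j * fromℕ (lookup h j) * recip (count A h)))
          ≈⟨ *-distribʳ-sum _ (λ j → χ A j * fromℕ (lookup h j)) ⟨
        (∑[ j < n ] (χ A j * fromℕ (lookup h j))) * recip (count A h)
          ≈⟨ *-congʳ (fromℕ-count A h) ⟨
        fromℕ (count A h) * recip (count A h)
          ≈⟨ trans (*-comm _ _) (recip-inverseˡ _ {{count≢0}}) ⟩
        1# ∎
    }

  -- The law of the answer to a query when μ is proportional to h.
  answer : Vec ℕ n → Query n → Distribution n
  answer h Q = restrict Q (effective (proj₁ Q) h) (count-effective-nonZero Q h)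

  answer-nonempty : ∀ h (Q : Query n) j .{{_ : NonZero (count (proj₁ Q) h)}} →
    pmf (answer h Q) j ≡ χ (proj₁ Q) j * (fromℕ (lookup h j) * recip (count (proj₁ Q) h))
  answer-nonempty h Q j =
    ≡.cong (λ h′ → χ (proj₁ Q) j * (fromℕ (lookup h′ j) * recip (count (proj₁ Q) h′)))
           (effective-nonempty (proj₁ Q) h)

  -- The answers when μ is uniform.
  uniformAnswer : Query n → Distribution n
  uniformAnswer = answer ones

  pmf-uniformAnswer : ∀ (Q : Query n) j →
    pmf (uniformAnswer Q) j ≈ χ (proj₁ Q) j * recip (count (proj₁ Q) ones)
  pmf-uniformAnswer Q j = *-congˡ (begin-equality
    fromℕ (lookup (effective (proj₁ Q) ones) j) * recip (count (proj₁ Q) (effective (proj₁ Q) ones))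
      ≈⟨ reflexive (≡.cong (λ h → fromℕ (lookup h j) * recip (count (proj₁ Q) h))
           (effective-nonempty (proj₁ Q) ones {{count-ones-nonZero {Q}}})) ⟩
    fromℕ (lookup ones j) * r
      ≈⟨ *-congʳ (trans (reflexive (≡.cong fromℕ (lookup-ones j))) fromℕ-1) ⟩
    1# * r
      ≈⟨ *-identityˡ r ⟩
    r ∎)
    where r = recip (count (proj₁ Q) ones)

  answer-empty : ∀ h (Q : Query n) j → count (proj₁ Q) h ≡ 0 →
                 pmf (answer h Q) j ≡ pmf (uniformAnswer Q) j
  answer-empty h Q j eq =
    ≡.cong (λ h′ → χ (proj₁ Q) j * (fromℕ (lookup h′ j) * recip (count (proj₁ Q) h′)))
           (≡.trans (effective-empty (proj₁ Q) h eq)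
                    (≡.sym (effective-nonempty (proj₁ Q) ones {{count-ones-nonZero {Q}}})))

  -- The comparison holds for any division of the queries into big and small
  -- ones; the sizes matter only for the quality of the bounds.
  module Comparison (big : Query n → Bool) where

    -- The law of an answer without its normalising factor for a big query, and
    -- the uniform law for a small one.
    weight : Vec ℕ n → Query n → Fin n → Carrier
    weight h Q j = if big Q then χ (proj₁ Q) j * fromℕ (lookup h j) else pmf (uniformAnswer Q) j

    weight-nonneg : ∀ h Q j → 0# ≤ weight h Q j
    weight-nonneg h Q j with big Q
    ... | true  = 0≤x*y (χ-nonneg (proj₁ Q) j) (fromℕ-nonneg (lookup h j))
    ... | false = nonneg (uniformAnswer Q) j

    -- The integral of f against the product of these weights.
    𝕎 : ∀ {t} → Vec ℕ n → Vec (Query n) t → (Vec (Fin n) t → Carrier) → Carrier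
    𝕎 h []       f = f []
    𝕎 h (Q ∷ Qs) f = ∑[ j < n ] (weight h Q j * 𝕎 h Qs (λ js → f (j ∷ js)))

    -- The product of the numbers of points in the big queries, each increased by
    -- 1 + b.  The 1 keeps the product nonzero, and b makes room for points that are
    -- added later.
    sizes : ∀ {t} → ℕ → Vec ℕ n → Vec (Query n) t → ℕ
    sizes b h []       = 1
    sizes b h (Q ∷ Qs) = (if big Q then ℕ.suc (b ℕ.+ count (proj₁ Q) h) else 1) ℕ.* sizes b h Qs

    -- The number of points in small queries, with multiplicity.
    smallHits : ∀ {t} → Vec ℕ n → Vec (Query n) t → ℕ
    smallHits h []       = 0
    smallHits h (Q ∷ Qs) = (if big Q then 0 else count (proj₁ Q) h) ℕ.+ smallHits h Qs

    𝕎-nonneg : ∀ {t} h (Qs : Vec (Query n) t) {f : Vec (Fin n) t → Carrier} →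
               (∀ js → 0# ≤ f js) → 0# ≤ 𝕎 h Qs f
    𝕎-nonneg h []       0≤f = 0≤f []
    𝕎-nonneg h (Q ∷ Qs) 0≤f = sum-nonneg {n} λ j →
      0≤x*y (weight-nonneg h Q j) (𝕎-nonneg h Qs (λ js → 0≤f (j ∷ js)))

    weight-bump-≤ : ∀ x h Q j → weight h Q j ≤ weight (bump x h) Q j
    weight-bump-≤ x h Q j with big Q
    ... | true  = *-monoʳ-≤ _ (χ-nonneg (proj₁ Q) j) (fromℕ-mono-≤ (lookup-bump-≤ j x h))
    ... | false = ≤-refl

    𝕎-bump-≤ : ∀ {t} x h (Qs : Vec (Query n) t) {f : Vec (Fin n) t → Carrier} →
               (∀ js → 0# ≤ f js) → 𝕎 h Qs f ≤ 𝕎 (bump x h) Qs f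
    𝕎-bump-≤ x h []       0≤f = ≤-refl
    𝕎-bump-≤ x h (Q ∷ Qs) 0≤f = sum-mono-≤ {n} λ j →
      *-mono-≤ (weight-nonneg h Q j) (𝕎-nonneg (bump x h) Qs (λ js → 0≤f (j ∷ js)))
               (weight-bump-≤ x h Q j) (𝕎-bump-≤ x h Qs (λ js → 0≤f (j ∷ js)))

    sizes-nonZero : ∀ {t} b h (Qs : Vec (Query n) t) → NonZero (sizes b h Qs)
    sizes-nonZero b h []       = _
    sizes-nonZero b h (Q ∷ Qs) with big Q
    ... | true  = ℕ.m*n≢0 (ℕ.suc (b ℕ.+ count (proj₁ Q) h)) _ {{_}} {{sizes-nonZero b h Qs}}
    ... | false = ℕ.m*n≢0 1 _ {{_}} {{sizes-nonZero b h Qs}}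

    sizes-mono : ∀ {t} {b b′ h h′} →
                 (∀ A → b ℕ.+ count A h ℕ.≤ b′ ℕ.+ count A h′) →
                 (Qs : Vec (Query n) t) → sizes b h Qs ℕ.≤ sizes b′ h′ Qs
    sizes-mono ≤ᶜ []       = ℕ.≤-refl
    sizes-mono ≤ᶜ (Q ∷ Qs) with big Q
    ... | true  = ℕ.*-mono-≤ (ℕ.s≤s (≤ᶜ (proj₁ Q))) (sizes-mono ≤ᶜ Qs)
    ... | false = ℕ.*-monoʳ-≤ 1 (sizes-mono ≤ᶜ Qs)

    sizes-bump-≤ : ∀ {t} b x h (Qs : Vec (Query n) t) →
                   sizes b (bump x h) Qs ℕ.≤ sizes (ℕ.suc b) h Qs
    sizes-bump-≤ b x h = sizes-mono λ A →
      ℕ.≤-trans (ℕ.+-monoʳ-≤ b (count-bump-≤ A x h)) (ℕ.≤-reflexive (ℕ.+-suc b _))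

    -- The total weight of a big query is its number of points.
    𝕎-≤-sizes : ∀ {t} h (Qs : Vec (Query n) t) {f : Vec (Fin n) t → Carrier} →
                (∀ js → f js ≤ 1#) → 𝕎 h Qs f ≤ fromℕ (sizes 0 h Qs)
    𝕎-≤-sizes h []       f≤1 = ≤-trans (f≤1 []) (≤-reflexive (sym fromℕ-1))
    𝕎-≤-sizes h (Q ∷ Qs) {f} f≤1 = begin
      (∑[ j < n ] (weight h Q j * 𝕎 h Qs (λ js → f (j ∷ js))))
        ≤⟨ sum-mono-≤ {n} (λ j → *-monoʳ-≤ _ (weight-nonneg h Q j) (𝕎-≤-sizes h Qs (λ js → f≤1 (j ∷ js)))) ⟩
      (∑[ j < n ] (weight h Q j * Z))
        ≈⟨ *-distribʳ-sum Z (weight h Q) ⟨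
      (∑[ j < n ] weight h Q j) * Z
        ≤⟨ *-monoˡ-≤ Z (fromℕ-nonneg (sizes 0 h Qs)) ∑-weight ⟩
      fromℕ (if big Q then ℕ.suc (count (proj₁ Q) h) else 1) * Z
        ≈⟨ fromℕ-* (if big Q then ℕ.suc (count (proj₁ Q) h) else 1) (sizes 0 h Qs) ⟨
      fromℕ (sizes 0 h (Q ∷ Qs)) ∎
      where
      Z = fromℕ (sizes 0 h Qs)
      ∑-weight : (∑[ j < n ] weight h Q j) ≤ fromℕ (if big Q then ℕ.suc (count (proj₁ Q) h) else 1)
      ∑-weight with big Q
      ... | true  = ≤-trans (≤-reflexive (sym (fromℕ-count (proj₁ Q) h)))
                            (fromℕ-mono-≤ (ℕ.n≤1+n (count (proj₁ Q) h)))
      ... | false = ≤-reflexive (trans (total (uniformAnswer Q)) (sym fromℕ-1))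

    𝕎-≤-1 : ∀ {t} h (Qs : Vec (Query n) t) {f : Vec (Fin n) t → Carrier} w →
            0# ≤ w → w * fromℕ (sizes 0 h Qs) ≤ 1# → (∀ js → f js ≤ 1#) → w * 𝕎 h Qs f ≤ 1#
    𝕎-≤-1 h Qs w 0≤w wZ≤1 f≤1 = ≤-trans (*-monoʳ-≤ w 0≤w (𝕎-≤-sizes h Qs f≤1)) wZ≤1

    -- If the points miss the small queries, then the law of the answers is the
    -- product of the weights divided by the product of the numbers of points in
    -- the big queries, which is at most Z = sizes 0 h Qs (when one of these
    -- numbers is 0, the weights vanish); otherwise smallHits is at least 1 and the
    -- bound is trivial.  A factor w with w Z ≤ 1 replaces 1 / Z, so that the factor
    -- for one query can be moved into w in the induction.
    𝕎-≤-𝔼 : ∀ {t} h (Qs : Vec (Query n) t) {f : Vec (Fin n) t → Carrier} w →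
      0# ≤ w → w * fromℕ (sizes 0 h Qs) ≤ 1# →
      (∀ js → 0# ≤ f js) → (∀ js → f js ≤ 1#) →
      w * 𝕎 h Qs f ≤ 𝔼 (Vec.map (answer h) Qs) f + fromℕ (smallHits h Qs)
    𝕎-≤-𝔼 h [] {f} w 0≤w wZ≤1 0≤f f≤1 = begin
      w * f []      ≤⟨ *-monoˡ-≤ (f []) (0≤f []) w≤1 ⟩
      1# * f []     ≈⟨ *-identityˡ _ ⟩
      f []          ≈⟨ +-identityʳ _ ⟨
      f [] + 0#     ∎
      where
      w≤1 : w ≤ 1#
      w≤1 = ≤-trans (≤-reflexive (sym (trans (*-congˡ fromℕ-1) (*-identityʳ w)))) wZ≤1
    𝕎-≤-𝔼 h (Q@(A , _) ∷ Qs) {f} w 0≤w wZ≤1 0≤f f≤1 with big Q in isBig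
    ... | true = go (count A h) ≡.refl
      where
      Y X : Fin n → Carrier
      Y j = 𝕎 h Qs (λ js → f (j ∷ js))
      X j = 𝔼 (Vec.map (answer h) Qs) (λ js → f (j ∷ js))
      E = fromℕ (smallHits h Qs)
      u : Fin n → Carrier
      u j = χ A j * fromℕ (lookup h j)
      go : ∀ N → count A h ≡ N → w * (∑[ j < n ] (u j * Y j)) ≤ (∑[ j < n ] (pmf (answer h Q) j * X j)) + E
      go ℕ.zero eq = begin
        w * (∑[ j < n ] (u j * Y j))  ≈⟨ *-congˡ (sum-cong {n} λ j → trans (*-congʳ (u≈0 j)) (zeroˡ _)) ⟩
        w * (∑[ j < n ] 0#)           ≈⟨ trans (*-congˡ (sum-replicate-zero n)) (zeroʳ w) ⟩
        0#                            ≤⟨ 0≤x+y (sum-nonneg {n} (λ j → 0≤x*y (nonneg (answer h Q) j)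
                                           (𝔼-nonneg (Vec.map (answer h) Qs) (λ js → 0≤f (j ∷ js))))) (fromℕ-nonneg (smallHits h Qs)) ⟩
        (∑[ j < n ] (pmf (answer h Q) j * X j)) + E ∎
        where
        u≈0 : ∀ j → u j ≈ 0#
        u≈0 j with lookup A j in j∈A
        ... | true  = trans (*-congˡ (reflexive (≡.cong fromℕ (count≡0⇒lookup≡0 A h eq j∈A)))) (zeroʳ _)
        ... | false = zeroˡ _
      go N@(ℕ.suc _) eq = begin
        w * (∑[ j < n ] (u j * Y j))
          ≈⟨ *-distribˡ-sum w (λ j → u j * Y j) ⟩
        (∑[ j < n ] (w * (u j * Y j)))
          ≈⟨ sum-cong {n} normalise ⟩
        (∑[ j < n ] (pmf (answer h Q) j * (w * fromℕ N * Y j)))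
          ≤⟨ mean-mono (answer h Q) (λ j → 𝕎-≤-𝔼 h Qs (w * fromℕ N) (0≤x*y 0≤w (fromℕ-nonneg N)) wNZ≤1
                                              (λ js → 0≤f (j ∷ js)) (λ js → f≤1 (j ∷ js))) ⟩
        (∑[ j < n ] (pmf (answer h Q) j * (X j + E)))
          ≈⟨ trans (mean-+ (answer h Q) X (λ _ → E)) (+-congˡ (mean-const (answer h Q) E)) ⟩
        (∑[ j < n ] (pmf (answer h Q) j * X j)) + E ∎
        where
        wNZ≤1 : w * fromℕ N * fromℕ (sizes 0 h Qs) ≤ 1#
        wNZ≤1 = begin
          w * fromℕ N * fromℕ (sizes 0 h Qs)      ≈⟨ trans (*-assoc _ _ _) (*-congˡ (sym (fromℕ-* N (sizes 0 h Qs)))) ⟩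
          w * fromℕ (N ℕ.* sizes 0 h Qs)          ≤⟨ *-monoʳ-≤ w 0≤w (fromℕ-mono-≤ (ℕ.*-monoˡ-≤ (sizes 0 h Qs)
                                                       (ℕ.≤-trans (ℕ.n≤1+n N) (ℕ.≤-reflexive (≡.cong ℕ.suc (≡.sym eq)))))) ⟩
          w * fromℕ (ℕ.suc (count A h) ℕ.* sizes 0 h Qs)    ≤⟨ wZ≤1 ⟩
          1#                                      ∎
        normalise : ∀ j → w * (u j * Y j) ≈ pmf (answer h Q) j * (w * fromℕ N * Y j)
        normalise j = begin-equality
          w * (χ A j * hⱼ * Y j)
            ≈⟨ *-congʳ (trans (*-congʳ (recip-inverseˡ N)) (*-identityˡ w)) ⟨
          recip N * fromℕ N * w * (χ A j * hⱼ * Y j)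
            ≈⟨ solve 6 (λ r N w c h y → r :* N :* w :* (c :* h :* y) := c :* (h :* r) :* (w :* N :* y)) refl _ _ _ _ _ _ ⟩
          χ A j * (hⱼ * recip N) * (w * fromℕ N * Y j)
            ≈⟨ *-congʳ (reflexive (≡.trans (answer-nonempty h Q j {{≡.subst NonZero (≡.sym eq) _}})
                                           (≡.cong (λ k → χ A j * (hⱼ * recip k)) eq))) ⟨
          pmf (answer h Q) j * (w * fromℕ N * Y j) ∎
          where hⱼ = fromℕ (lookup h j)
    ... | false = go (count A h) ≡.refl
      where
      Y X : Fin n → Carrier
      Y j = 𝕎 h Qs (λ js → f (j ∷ js))
      X j = 𝔼 (Vec.map (answer h) Qs) (λ js → f (j ∷ js))
      wZ≤1′ : w * fromℕ (sizes 0 h Qs) ≤ 1#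
      wZ≤1′ = ≤-trans (≤-reflexive (*-congˡ (reflexive (≡.cong fromℕ (≡.sym (ℕ.*-identityˡ (sizes 0 h Qs))))))) wZ≤1
      push : w * (∑[ j < n ] (pmf (uniformAnswer Q) j * Y j)) ≈
             (∑[ j < n ] (pmf (uniformAnswer Q) j * (w * Y j)))
      push = trans (*-distribˡ-sum w (λ j → pmf (uniformAnswer Q) j * Y j))
        (sum-cong {n} λ j → solve 3 (λ w u y → w :* (u :* y) := u :* (w :* y)) refl _ _ _)
      go : ∀ N → count A h ≡ N → w * (∑[ j < n ] (pmf (uniformAnswer Q) j * Y j)) ≤
           (∑[ j < n ] (pmf (answer h Q) j * X j)) + fromℕ (count A h ℕ.+ smallHits h Qs)
      go ℕ.zero eq = begin
        w * (∑[ j < n ] (pmf (uniformAnswer Q) j * Y j))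
          ≈⟨ push ⟩
        (∑[ j < n ] (pmf (uniformAnswer Q) j * (w * Y j)))
          ≈⟨ sum-cong {n} (λ j → *-congʳ (reflexive (answer-empty h Q j eq))) ⟨
        (∑[ j < n ] (pmf (answer h Q) j * (w * Y j)))
          ≤⟨ mean-mono (answer h Q) (λ j → 𝕎-≤-𝔼 h Qs w 0≤w wZ≤1′ (λ js → 0≤f (j ∷ js)) (λ js → f≤1 (j ∷ js))) ⟩
        (∑[ j < n ] (pmf (answer h Q) j * (X j + fromℕ (smallHits h Qs))))
          ≈⟨ trans (mean-+ (answer h Q) X (λ _ → fromℕ (smallHits h Qs))) (+-congˡ (mean-const (answer h Q) _)) ⟩
        (∑[ j < n ] (pmf (answer h Q) j * X j)) + fromℕ (smallHits h Qs)
          ≈⟨ +-congˡ (reflexive (≡.cong (λ k → fromℕ (k ℕ.+ smallHits h Qs)) eq)) ⟨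
        (∑[ j < n ] (pmf (answer h Q) j * X j)) + fromℕ (count A h ℕ.+ smallHits h Qs) ∎
      go (ℕ.suc N) eq = begin
        w * (∑[ j < n ] (pmf (uniformAnswer Q) j * Y j))
          ≈⟨ push ⟩
        (∑[ j < n ] (pmf (uniformAnswer Q) j * (w * Y j)))
          ≤⟨ mean-mono (uniformAnswer Q) (λ j → 𝕎-≤-1 h Qs w 0≤w wZ≤1′ (λ js → f≤1 (j ∷ js))) ⟩
        (∑[ j < n ] (pmf (uniformAnswer Q) j * 1#))
          ≈⟨ mean-const (uniformAnswer Q) 1# ⟩
        1#
          ≈⟨ fromℕ-1 ⟨
        fromℕ 1
          ≤⟨ fromℕ-mono-≤ (ℕ.≤-trans (ℕ.s≤s ℕ.z≤n) (ℕ.≤-trans (ℕ.≤-reflexive (≡.sym eq)) (ℕ.m≤m+n _ (smallHits h Qs)))) ⟩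
        fromℕ (count A h ℕ.+ smallHits h Qs)
          ≤⟨ ≤-+ˡ _ (sum-nonneg {n} (λ j → 0≤x*y (nonneg (answer h Q) j)
                      (𝔼-nonneg (Vec.map (answer h) Qs) (λ js → 0≤f (j ∷ js))))) ≤-refl ⟩
        (∑[ j < n ] (pmf (answer h Q) j * X j)) + fromℕ (count A h ℕ.+ smallHits h Qs) ∎

-- Comparison at a good scale

module GoodScale {c ℓ₁ ℓ₂ : Level} (𝔽 : OrderedField c ℓ₁ ℓ₂) (n : ℕ) .{{n≢0 : NonZero n}}
                 (big : UniformityTesting.Query 𝔽 n → Bool) where

  open OrderedFieldProperties 𝔽
  open SemiringExp semiring using (_^_)
  open UniformityTesting 𝔽
  open Draws 𝔽 n
  open ConditionalLaws 𝔽 n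
  open Expectations 𝔽
  open Comparison big

  -- The product of the expected numbers of s points in the big queries.
  nominal : ∀ {t} → ℕ → Vec (Query n) t → Carrier
  nominal s []       = 1#
  nominal s (Q ∷ Qs) = (if big Q then density s (proj₁ Q) else 1#) * nominal s Qs

  density-nonneg : ∀ s A → 0# ≤ density s A
  density-nonneg s A = 0≤x*y (fromℕ-nonneg s) (0≤x*y (fromℕ-nonneg (count A ones)) (1/-nonneg n))

  nominal-nonneg : ∀ {t} s (Qs : Vec (Query n) t) → 0# ≤ nominal s Qs
  nominal-nonneg s []       = 0≤1
  nominal-nonneg s (Q ∷ Qs) with big Q
  ... | true  = 0≤x*y (density-nonneg s (proj₁ Q)) (nominal-nonneg s Qs)
  ... | false = 0≤x*y 0≤1 (nominal-nonneg s Qs)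

  nominal-inverse : ∀ {t} s .{{_ : NonZero s}} (Qs : Vec (Query n) t) →
                    ∃[ v ] (0# ≤ v × v * nominal s Qs ≈ 1#)
  nominal-inverse s []       = 1# , 0≤1 , *-identityˡ 1#
  nominal-inverse s (Q ∷ Qs) with big Q | nominal-inverse s Qs
  ... | false | v , 0≤v , eq = v , 0≤v , trans (*-congˡ (*-identityˡ _)) eq
  ... | true  | v , 0≤v , eq =
    recip s * recip a * fromℕ n * v ,
    0≤x*y (0≤x*y (0≤x*y (recip-nonneg s) (recip-nonneg a)) (fromℕ-nonneg n)) 0≤v ,
    (begin-equality
      recip s * recip a * fromℕ n * v * (fromℕ s * (fromℕ a * (1/ n)) * nominal s Qs)
        ≈⟨ solve 8 (λ rs ra m v s a ι C → rs :* ra :* m :* v :* (s :* (a :* ι) :* C)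
                      := (rs :* s) :* (ra :* a) :* (m :* ι) :* (v :* C)) refl _ _ _ _ _ _ _ _ ⟩
      (recip s * fromℕ s) * (recip a * fromℕ a) * (fromℕ n * (1/ n)) * (v * nominal s Qs)
        ≈⟨ *-cong (*-cong (*-cong (recip-inverseˡ s) (recip-inverseˡ a {{count-ones-nonZero {Q}}}))
                          (⁻¹-inverseʳ (fromℕ n) (fromℕ-pos n))) eq ⟩
      1# * 1# * 1# * 1#
        ≈⟨ solve 0 (con 1 :* con 1 :* con 1 :* con 1 := con 1) refl ⟩
      1# ∎)
    where a = count (proj₁ Q) ones

  -- Repeated removal of points.  Each big query contributes the factor s|A|/n to
  -- nominal and |A|⁻¹ to the uniform law; g, which stands for the reciprocal
  -- of the sizes, pays for each point removed by an increase of b.  At a small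
  -- query no point is removed, and one of the points drawn is dropped.
  plant : ∀ {t} b s (g : ℕ → Vec ℕ n → Carrier) →
    (∀ b h → 0# ≤ g b h) → (∀ b x h → g (ℕ.suc b) h ≤ g b (bump x h)) →
    (Qs : Vec (Query n) t) (f : Vec (Fin n) t → Carrier) → (∀ js → 0# ≤ f js) →
    nominal s Qs * (𝔼 (Vec.map uniformAnswer Qs) f * draw s (g (t ℕ.+ b))) ≤
    draw (t ℕ.+ s) (λ h → g b h * 𝕎 h Qs f)
  plant b s g 0≤g g-bump [] f 0≤f = ≤-reflexive (begin-equality
    1# * (f [] * draw s (g b))        ≈⟨ *-identityˡ _ ⟩
    f [] * draw s (g b)               ≈⟨ draw-* s (f []) (g b) ⟨
    draw s (λ h → f [] * g b h)       ≈⟨ draw-cong s (λ h → *-comm _ _) ⟩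
    draw s (λ h → g b h * f [])       ∎)
  plant {ℕ.suc t} b s g 0≤g g-bump (Q@(A , _) ∷ Qs) f 0≤f with big Q in isBig
  ... | true = begin
    density s A * C * ((∑[ j < n ] (pmf (uniformAnswer Q) j * U j)) * D)
      ≈⟨ *-congˡ (*-distribʳ-sum D (λ j → pmf (uniformAnswer Q) j * U j)) ⟩
    density s A * C * (∑[ j < n ] (pmf (uniformAnswer Q) j * U j * D))
      ≈⟨ *-distribˡ-sum _ (λ j → pmf (uniformAnswer Q) j * U j * D) ⟩
    (∑[ j < n ] (density s A * C * (pmf (uniformAnswer Q) j * U j * D)))
      ≈⟨ sum-cong {n} rearrange ⟩
    (∑[ j < n ] (χ A j * (fromℕ s * ((1/ n) * (C * (U j * D))))))
      ≤⟨ sum-mono-≤ {n} (λ j → *-monoʳ-≤ _ (χ-nonneg A j)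
           (*-mono-≤ (fromℕ-nonneg s) (0≤x*y (1/-nonneg n) (0≤R j))
             (fromℕ-mono-≤ (ℕ.≤-trans (ℕ.m≤n+m s t) (ℕ.n≤1+n (t ℕ.+ s))))
             (*-monoʳ-≤ _ (1/-nonneg n) (step j)))) ⟩
    (∑[ j < n ] (χ A j * (fromℕ (ℕ.suc t ℕ.+ s) * ((1/ n) * R j))))
      ≈⟨ sum-cong {n} (λ j → *-congˡ (draw-lookup (t ℕ.+ s) j (λ h → g b h * W j h))) ⟨
    (∑[ j < n ] (χ A j * draw (ℕ.suc t ℕ.+ s) (λ h → fromℕ (lookup h j) * (g b h * W j h))))
      ≈⟨ sum-cong {n} (λ j → draw-* (ℕ.suc t ℕ.+ s) (χ A j) (λ h → fromℕ (lookup h j) * (g b h * W j h))) ⟨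
    (∑[ j < n ] draw (ℕ.suc t ℕ.+ s) (λ h → χ A j * (fromℕ (lookup h j) * (g b h * W j h))))
      ≈⟨ draw-∑ (ℕ.suc t ℕ.+ s) (λ j h → χ A j * (fromℕ (lookup h j) * (g b h * W j h))) ⟨
    draw (ℕ.suc t ℕ.+ s) (λ h → ∑[ j < n ] (χ A j * (fromℕ (lookup h j) * (g b h * W j h))))
      ≈⟨ draw-cong (ℕ.suc t ℕ.+ s) (λ h → trans
           (*-distribˡ-sum (g b h) (λ j → χ A j * fromℕ (lookup h j) * W j h))
           (sum-cong {n} λ j → solve 4 (λ g c h w → g :* (c :* h :* w) := c :* (h :* (g :* w))) refl _ _ _ _)) ⟨
    draw (ℕ.suc t ℕ.+ s) (λ h → g b h * (∑[ j < n ] (χ A j * fromℕ (lookup h j) * W j h))) ∎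
    where
    C = nominal s Qs
    D = draw s (g (ℕ.suc t ℕ.+ b))
    f⟨_⟩ : Fin n → Vec (Fin n) t → Carrier
    f⟨ j ⟩ js = f (j ∷ js)
    W : Fin n → Vec ℕ n → Carrier
    W j h = 𝕎 h Qs f⟨ j ⟩
    U R : Fin n → Carrier
    U j = 𝔼 (Vec.map uniformAnswer Qs) f⟨ j ⟩
    R j = draw (t ℕ.+ s) (λ h → g b (bump j h) * W j (bump j h))
    0≤W : ∀ j h → 0# ≤ W j h
    0≤W j h = 𝕎-nonneg h Qs λ js → 0≤f (j ∷ js)
    0≤R : ∀ j → 0# ≤ R j
    0≤R j = draw-nonneg (t ℕ.+ s) λ h → 0≤x*y (0≤g b (bump j h)) (0≤W j (bump j h))
    rearrange : ∀ j → density s A * C * (pmf (uniformAnswer Q) j * U j * D) ≈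
                      χ A j * (fromℕ s * ((1/ n) * (C * (U j * D))))
    rearrange j = begin-equality
      fromℕ s * (fromℕ a * (1/ n)) * C * (pmf (uniformAnswer Q) j * U j * D)
        ≈⟨ *-congˡ (*-congʳ (*-congʳ (pmf-uniformAnswer Q j))) ⟩
      fromℕ s * (fromℕ a * (1/ n)) * C * (χ A j * recip a * U j * D)
        ≈⟨ solve 8 (λ s a ι C χ r U D → s :* (a :* ι) :* C :* (χ :* r :* U :* D)
                      := (r :* a) :* (χ :* (s :* (ι :* (C :* (U :* D)))))) refl _ _ _ _ _ _ _ _ ⟩
      (recip a * fromℕ a) * (χ A j * (fromℕ s * ((1/ n) * (C * (U j * D)))))
        ≈⟨ trans (*-congʳ (recip-inverseˡ a {{count-ones-nonZero {Q}}})) (*-identityˡ _) ⟩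
      χ A j * (fromℕ s * ((1/ n) * (C * (U j * D)))) ∎
      where a = count A ones
    step : ∀ j → C * (U j * D) ≤ R j
    step j = begin
      C * (U j * D)
        ≈⟨ *-congˡ (*-congˡ (reflexive (≡.cong (λ k → draw s (g k)) (≡.sym (ℕ.+-suc t b))))) ⟩
      C * (U j * draw s (g (t ℕ.+ ℕ.suc b)))
        ≤⟨ plant (ℕ.suc b) s g 0≤g g-bump Qs f⟨ j ⟩ (λ js → 0≤f (j ∷ js)) ⟩
      draw (t ℕ.+ s) (λ h → g (ℕ.suc b) h * W j h)
        ≤⟨ draw-mono (t ℕ.+ s) (λ h → *-mono-≤ (0≤g (ℕ.suc b) h) (0≤W j (bump j h)) (g-bump b j h)
             (𝕎-bump-≤ j h Qs (λ js → 0≤f (j ∷ js)))) ⟩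
      R j ∎
  ... | false = begin
    1# * C * ((∑[ j < n ] (u j * U j)) * D)
      ≈⟨ *-cong (*-identityˡ C) (*-distribʳ-sum D (λ j → u j * U j)) ⟩
    C * (∑[ j < n ] (u j * U j * D))
      ≈⟨ *-distribˡ-sum _ (λ j → u j * U j * D) ⟩
    (∑[ j < n ] (C * (u j * U j * D)))
      ≈⟨ sum-cong {n} (λ j → solve 4 (λ C u U D → C :* (u :* U :* D) := u :* (C :* (U :* D))) refl _ _ _ _) ⟩
    (∑[ j < n ] (u j * (C * (U j * D))))
      ≤⟨ sum-mono-≤ {n} (λ j → *-monoʳ-≤ _ (nonneg (uniformAnswer Q) j) (step j)) ⟩
    (∑[ j < n ] (u j * draw (t ℕ.+ s) (λ h → g (ℕ.suc b) h * W j h)))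
      ≈⟨ sum-cong {n} (λ j → draw-* (t ℕ.+ s) (u j) (λ h → g (ℕ.suc b) h * W j h)) ⟨
    (∑[ j < n ] draw (t ℕ.+ s) (λ h → u j * (g (ℕ.suc b) h * W j h)))
      ≈⟨ draw-∑ (t ℕ.+ s) (λ j h → u j * (g (ℕ.suc b) h * W j h)) ⟨
    draw (t ℕ.+ s) (λ h → ∑[ j < n ] (u j * (g (ℕ.suc b) h * W j h)))
      ≈⟨ draw-cong (t ℕ.+ s) (λ h → trans
           (*-distribˡ-sum (g (ℕ.suc b) h) (λ j → u j * W j h))
           (sum-cong {n} λ j → solve 3 (λ g u w → g :* (u :* w) := u :* (g :* w)) refl _ _ _)) ⟨
    draw (t ℕ.+ s) (λ h → g (ℕ.suc b) h * (∑[ j < n ] (u j * W j h)))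
      ≤⟨ draw-suc-≥ (t ℕ.+ s) {g = λ h → g b h * (∑[ j < n ] (u j * W j h))} (λ x h → *-mono-≤ (0≤g (ℕ.suc b) h) (sum-nonneg {n} (λ j → 0≤x*y (nonneg (uniformAnswer Q) j) (0≤W j (bump x h))))
           (g-bump b x h)
           (sum-mono-≤ {n} (λ j → *-monoʳ-≤ _ (nonneg (uniformAnswer Q) j) (𝕎-bump-≤ x h Qs (λ js → 0≤f (j ∷ js)))))) ⟩
    draw (ℕ.suc t ℕ.+ s) (λ h → g b h * (∑[ j < n ] (u j * W j h))) ∎
    where
    C = nominal s Qs
    D = draw s (g (ℕ.suc t ℕ.+ b))
    f⟨_⟩ : Fin n → Vec (Fin n) t → Carrier
    f⟨ j ⟩ js = f (j ∷ js)
    W : Fin n → Vec ℕ n → Carrier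
    W j h = 𝕎 h Qs f⟨ j ⟩
    u U : Fin n → Carrier
    u = pmf (uniformAnswer Q)
    U j = 𝔼 (Vec.map uniformAnswer Qs) f⟨ j ⟩
    0≤W : ∀ j h → 0# ≤ W j h
    0≤W j h = 𝕎-nonneg h Qs λ js → 0≤f (j ∷ js)
    step : ∀ j → C * (U j * D) ≤ draw (t ℕ.+ s) (λ h → g (ℕ.suc b) h * W j h)
    step j = begin
      C * (U j * D)
        ≈⟨ *-congˡ (*-congˡ (reflexive (≡.cong (λ k → draw s (g k)) (≡.sym (ℕ.+-suc t b))))) ⟩
      C * (U j * draw s (g (t ℕ.+ ℕ.suc b)))
        ≤⟨ plant (ℕ.suc b) s g 0≤g g-bump Qs f⟨ j ⟩ (λ js → 0≤f (j ∷ js)) ⟩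
      draw (t ℕ.+ s) (λ h → g (ℕ.suc b) h * W j h) ∎

  -- What the size of a query must satisfy at a scale: K is at most η times the
  -- expected number of s points in a big query, and the expected number of S
  -- points in a small query is at most θ.
  Good : ℕ → ℕ → ℕ → Carrier → Carrier → Query n → Set _
  Good s S K η θ (A , ne) =
    (big (A , ne) ≡ true × fromℕ K ≤ η * density s A) ⊎ (big (A , ne) ≡ false × density S A ≤ θ)

  1≤[1+η]^ : ∀ t {η} → 0# ≤ η → 1# ≤ (1# + η) ^ t
  1≤[1+η]^ ℕ.zero    0≤η = ≤-refl
  1≤[1+η]^ (ℕ.suc t) {η} 0≤η = begin
    1#                          ≤⟨ 1≤[1+η]^ t 0≤η ⟩
    (1# + η) ^ t                ≤⟨ ≤-+ʳ _ (0≤x*y 0≤η (≤-trans 0≤1 (1≤[1+η]^ t 0≤η))) ≤-refl ⟩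
    (1# + η) ^ t + η * (1# + η) ^ t  ≈⟨ trans (distribʳ _ _ _) (+-congʳ (*-identityˡ _)) ⟨
    (1# + η) ^ ℕ.suc t          ∎

  -- An upper counterpart of Bernoulli's inequality.
  [1+η]^-≤ : ∀ t {η} → 0# ≤ η → fromℕ t * (η + η) ≤ 1# →
             (1# + η) ^ t ≤ 1# + fromℕ t * (η + η)
  [1+η]^-≤ ℕ.zero    {η} 0≤η small = ≤-reflexive (sym (trans (+-congˡ (zeroˡ _)) (+-identityʳ 1#)))
  [1+η]^-≤ (ℕ.suc t) {η} 0≤η small = begin
    (1# + η) * (1# + η) ^ t
      ≤⟨ *-monoʳ-≤ _ (0≤x+y 0≤1 0≤η) ([1+η]^-≤ t 0≤η T≤1) ⟩
    (1# + η) * (1# + T)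
      ≈⟨ solve 2 (λ η T → (con 1 :+ η) :* (con 1 :+ T) := con 1 :+ (η :+ T) :+ η :* T) refl η T ⟩
    1# + (η + T) + η * T
      ≤⟨ +-monoʳ-≤ _ (*-monoʳ-≤ η 0≤η T≤1) ⟩
    1# + (η + T) + η * 1#
      ≈⟨ solve 2 (λ η t → con 1 :+ (η :+ t :* (η :+ η)) :+ η :* con 1
                    := con 1 :+ (con 1 :+ t) :* (η :+ η)) refl η (fromℕ t) ⟩
    1# + fromℕ (ℕ.suc t) * (η + η) ∎
    where
    T = fromℕ t * (η + η)
    T≤1 : T ≤ 1#
    T≤1 = ≤-trans (*-monoˡ-≤ _ (0≤x+y 0≤η 0≤η) (fromℕ-mono-≤ (ℕ.n≤1+n t))) small

  -- As the expectation of a product of counts can exceed the product of the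
  -- expectations only through points lying in several queries, it is enough to
  -- increase b by one for each factor; K dominates all these increases.
  draw-sizes-≤ : ∀ {t} b s {S K η θ} → 0# ≤ η →
    (Qs : Vec (Query n) t) → All (Good s S K η θ) Qs → t ℕ.+ b ℕ.≤ K →
    draw s (λ h → fromℕ (sizes b h Qs)) ≤ (1# + η) ^ t * nominal s Qs
  draw-sizes-≤ b s 0≤η [] [] _ = ≤-reflexive
    (trans (draw-const s (fromℕ 1)) (trans fromℕ-1 (sym (*-identityˡ 1#))))
  draw-sizes-≤ {ℕ.suc t} b s {S} {K} {η} {θ} 0≤η (Q@(A , _) ∷ Qs) (good ∷ goods) t+b<K with big Q | good
  ... | true | inj₁ (_ , K≤ηd) = begin
    draw s (λ h → fromℕ (ℕ.suc (b ℕ.+ count A h) ℕ.* sizes b h Qs))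
      ≈⟨ draw-cong s (λ h → trans (fromℕ-* (ℕ.suc b ℕ.+ count A h) (sizes b h Qs))
           (trans (*-congʳ (fromℕ-+ (ℕ.suc b) (count A h))) (distribʳ _ _ _))) ⟩
    draw s (λ h → fromℕ (ℕ.suc b) * Z b h + fromℕ (count A h) * Z b h)
      ≈⟨ draw-+ s (λ h → fromℕ (ℕ.suc b) * Z b h) (λ h → fromℕ (count A h) * Z b h) ⟩
    draw s (λ h → fromℕ (ℕ.suc b) * Z b h) + draw s (λ h → fromℕ (count A h) * Z b h)
      ≈⟨ +-congʳ (draw-* s (fromℕ (ℕ.suc b)) (Z b)) ⟩
    fromℕ (ℕ.suc b) * draw s (Z b) + draw s (λ h → fromℕ (count A h) * Z b h)
      ≤⟨ +-mono-≤
           (*-mono-≤ (fromℕ-nonneg (ℕ.suc b)) 0≤Z′ suc-b≤ηd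
             (draw-mono s (λ h → fromℕ-mono-≤ (sizes-mono {b = b} {ℕ.suc b} (λ B → ℕ.n≤1+n _) Qs))))
           (draw-count-≤ s A {Z b} {Z (ℕ.suc b)} (λ h → fromℕ-nonneg (sizes (ℕ.suc b) h Qs))
             (λ x h → fromℕ-mono-≤ (sizes-bump-≤ b x h Qs))
             (λ x h → fromℕ-mono-≤ (sizes-mono (λ B → ℕ.+-monoʳ-≤ (ℕ.suc b) (count-≤-bump B x h)) Qs))) ⟩
    η * density s A * draw s (Z (ℕ.suc b)) + density s A * draw s (Z (ℕ.suc b))
      ≈⟨ solve 3 (λ η d z → η :* d :* z :+ d :* z := (con 1 :+ η) :* d :* z) refl _ _ _ ⟩
    (1# + η) * density s A * draw s (Z (ℕ.suc b))
      ≤⟨ *-monoʳ-≤ _ (0≤x*y (0≤x+y 0≤1 0≤η) (density-nonneg s A))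
           (draw-sizes-≤ (ℕ.suc b) s {S} {K} {θ = θ} 0≤η Qs goods (ℕ.≤-trans (ℕ.≤-reflexive (ℕ.+-suc t b)) t+b<K)) ⟩
    (1# + η) * density s A * ((1# + η) ^ t * nominal s Qs)
      ≈⟨ solve 4 (λ p d q C → p :* d :* (q :* C) := p :* q :* (d :* C)) refl _ _ _ _ ⟩
    (1# + η) ^ ℕ.suc t * (density s A * nominal s Qs) ∎
    where
    Z : ℕ → Vec ℕ n → Carrier
    Z b h = fromℕ (sizes b h Qs)
    0≤Z′ : 0# ≤ draw s (Z (ℕ.suc b))
    0≤Z′ = draw-nonneg s λ h → fromℕ-nonneg (sizes (ℕ.suc b) h Qs)
    suc-b≤ηd : fromℕ (ℕ.suc b) ≤ η * density s A
    suc-b≤ηd = ≤-trans (fromℕ-mono-≤ (ℕ.≤-trans (ℕ.s≤s (ℕ.m≤n+m b t)) t+b<K)) K≤ηd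
  ... | false | inj₂ _ = begin
    draw s (λ h → fromℕ (1 ℕ.* sizes b h Qs))
      ≈⟨ draw-cong s (λ h → reflexive (≡.cong fromℕ (ℕ.*-identityˡ (sizes b h Qs)))) ⟩
    draw s (λ h → fromℕ (sizes b h Qs))
      ≤⟨ draw-sizes-≤ b s {S} {K} {θ = θ} 0≤η Qs goods (ℕ.≤-trans (ℕ.n≤1+n _) t+b<K) ⟩
    (1# + η) ^ t * nominal s Qs
      ≤⟨ *-monoˡ-≤ _ (nominal-nonneg s Qs) (≤-trans
           (≤-+ʳ _ (0≤x*y 0≤η (≤-trans 0≤1 (1≤[1+η]^ t 0≤η))) (≤-reflexive (sym (*-identityˡ _))))
           (≤-reflexive (sym (distribʳ _ _ _)))) ⟩
    (1# + η) ^ ℕ.suc t * nominal s Qs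
      ≈⟨ *-congˡ (*-identityˡ _) ⟨
    (1# + η) ^ ℕ.suc t * (1# * nominal s Qs) ∎

  draw-smallHits-≤ : ∀ {t} {s} S {K η θ} → 0# ≤ θ →
    (Qs : Vec (Query n) t) → All (Good s S K η θ) Qs →
    draw S (λ h → fromℕ (smallHits h Qs)) ≤ fromℕ t * θ
  draw-smallHits-≤ S 0≤θ [] [] = ≤-reflexive (trans (draw-const S 0#) (sym (zeroˡ _)))
  draw-smallHits-≤ {ℕ.suc t} {s} S {K} {η} {θ} 0≤θ (Q@(A , _) ∷ Qs) (good ∷ goods) with big Q | good
  ... | true  | inj₁ _ = ≤-trans (draw-smallHits-≤ {s = s} S {K} {η} 0≤θ Qs goods)
                                 (*-monoˡ-≤ θ 0≤θ (fromℕ-mono-≤ (ℕ.n≤1+n t)))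
  ... | false | inj₂ (_ , d≤θ) = begin
    draw S (λ h → fromℕ (count A h ℕ.+ smallHits h Qs))
      ≈⟨ draw-cong S (λ h → trans (fromℕ-+ (count A h) (smallHits h Qs)) (+-congʳ (sym (*-identityʳ _)))) ⟩
    draw S (λ h → fromℕ (count A h) * 1# + fromℕ (smallHits h Qs))
      ≈⟨ draw-+ S (λ h → fromℕ (count A h) * 1#) (λ h → fromℕ (smallHits h Qs)) ⟩
    draw S (λ h → fromℕ (count A h) * 1#) + draw S (λ h → fromℕ (smallHits h Qs))
      ≤⟨ +-mono-≤ (draw-count-≤ S A (λ _ → 0≤1) (λ _ _ → ≤-refl) (λ _ _ → ≤-refl))
                  (draw-smallHits-≤ {s = s} S {K} {η} 0≤θ Qs goods) ⟩
    density S A * draw S (λ _ → 1#) + fromℕ t * θ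
      ≤⟨ +-monoˡ-≤ _ (≤-trans (≤-reflexive (trans (*-congˡ (draw-const S 1#)) (*-identityʳ _))) d≤θ) ⟩
    θ + fromℕ t * θ
      ≈⟨ solve 2 (λ θ t → θ :+ t :* θ := (con 1 :+ t) :* θ) refl _ _ ⟩
    fromℕ (ℕ.suc t) * θ ∎

  -- For y = 1 / x: the tangent at 1 bounds the convex function 1 / x from below.
  xy≈1⇒2≤x+y : ∀ {x y} → 0# ≤ y → y * x ≈ 1# → 1# + 1# ≤ x + y
  xy≈1⇒2≤x+y {x} {y} 0≤y yx≈1 = begin
    1# + 1#                   ≈⟨ +-cong yx≈1 yx≈1 ⟨
    y * x + y * x             ≈⟨ solve 2 (λ x y → y :* x :+ y :* x := y :* (x :* con 1 :+ x :* con 1)) refl x y ⟩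
    y * (x * 1# + x * 1#)     ≤⟨ *-monoʳ-≤ y 0≤y (2xy≤x²+y² x 1#) ⟩
    y * (x * x + 1# * 1#)     ≈⟨ solve 2 (λ x y → y :* (x :* x :+ con 1 :* con 1) := (y :* x) :* x :+ y) refl x y ⟩
    (y * x) * x + y           ≈⟨ +-congʳ (trans (*-congʳ yx≈1) (*-identityˡ x)) ⟩
    x + y                     ∎

  -- At a good scale a test f accepts a random hard instance almost as often as
  -- the uniform distribution.
  uniform-≤-draw : ∀ {t} s .{{_ : NonZero s}} {K η θ} → 0# ≤ η → 0# ≤ θ →
    fromℕ t * (η + η) ≤ 1# → t ℕ.+ t ℕ.≤ K →
    (Qs : Vec (Query n) t) → All (Good s (t ℕ.+ s) K η θ) Qs →
    (f : Vec (Fin n) t → Carrier) → (∀ js → 0# ≤ f js) → (∀ js → f js ≤ 1#) →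
    𝔼 (Vec.map uniformAnswer Qs) f ≤
    draw (t ℕ.+ s) (λ h → 𝔼 (Vec.map (answer h) Qs) f) + (fromℕ t * θ + fromℕ t * (η + η))
  uniform-≤-draw {t} s {K} {η} {θ} 0≤η 0≤θ small 2t≤K Qs goods f 0≤f f≤1 = begin
    U                              ≈⟨ *-identityʳ U ⟨
    U * 1#                         ≤⟨ *-monoʳ-≤ U 0≤U 1≤CD+τ ⟩
    U * (C * D + τ)                ≈⟨ solve 4 (λ U C D τ → U :* (C :* D :+ τ) := C :* (U :* D) :+ U :* τ) refl U C D τ ⟩
    C * (U * D) + U * τ            ≤⟨ +-mono-≤ (plant 0 s g 0≤g g-bump Qs f 0≤f)
                                        (≤-trans (*-monoˡ-≤ τ 0≤τ U≤1) (≤-reflexive (*-identityˡ τ))) ⟩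
    draw S (λ h → g 0 h * 𝕎 h Qs f) + τ
      ≤⟨ +-monoˡ-≤ τ (draw-mono S (λ h → 𝕎-≤-𝔼 h Qs (g 0 h) (0≤g 0 h)
           (≤-reflexive (recip-inverseˡ (sizes 0 h Qs) {{sizes-nonZero 0 h Qs}})) 0≤f f≤1)) ⟩
    draw S (λ h → X h + fromℕ (smallHits h Qs)) + τ
      ≈⟨ +-congʳ (draw-+ S X (λ h → fromℕ (smallHits h Qs))) ⟩
    draw S X + draw S (λ h → fromℕ (smallHits h Qs)) + τ
      ≤⟨ +-monoˡ-≤ τ (+-monoʳ-≤ (draw S X) (draw-smallHits-≤ {s = s} S {K} {η} 0≤θ Qs goods)) ⟩
    draw S X + fromℕ t * θ + τ     ≈⟨ +-assoc _ _ _ ⟩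
    draw S X + (fromℕ t * θ + τ)   ∎
    where
    S = t ℕ.+ s
    U = 𝔼 (Vec.map uniformAnswer Qs) f
    X : Vec ℕ n → Carrier
    X h = 𝔼 (Vec.map (answer h) Qs) f
    g : ℕ → Vec ℕ n → Carrier
    g b h = recip (sizes b h Qs)
    C = nominal s Qs
    D = draw s (g (t ℕ.+ 0))
    τ = fromℕ t * (η + η)
    0≤U : 0# ≤ U
    0≤U = 𝔼-nonneg (Vec.map uniformAnswer Qs) 0≤f
    U≤1 : U ≤ 1#
    U≤1 = ≤-trans (𝔼-mono (Vec.map uniformAnswer Qs) f≤1) (≤-reflexive (𝔼-const (Vec.map uniformAnswer Qs) 1#))
    0≤τ : 0# ≤ τ
    0≤τ = 0≤x*y (fromℕ-nonneg t) (0≤x+y 0≤η 0≤η)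
    0≤g : ∀ b h → 0# ≤ g b h
    0≤g b h = recip-nonneg (sizes b h Qs)
    g-bump : ∀ b x h → g (ℕ.suc b) h ≤ g b (bump x h)
    g-bump b x h = recip-antitone {{sizes-nonZero b (bump x h) Qs}} (sizes-bump-≤ b x h Qs)
    1≤CD+τ : 1# ≤ C * D + τ
    1≤CD+τ with nominal-inverse s Qs
    ... | v , 0≤v , vC≈1 = +-cancelʳ-≤ 1# (begin
      1# + 1#
        ≈⟨ draw-const s (1# + 1#) ⟨
      draw s (λ _ → 1# + 1#)
        ≤⟨ draw-mono s tangent ⟩
      draw s (λ h → C * g (t ℕ.+ 0) h + v * Z h)
        ≈⟨ trans (draw-+ s (λ h → C * g (t ℕ.+ 0) h) (λ h → v * Z h))
             (+-cong (draw-* s C (g (t ℕ.+ 0))) (draw-* s v Z)) ⟩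
      C * D + v * draw s Z
        ≤⟨ +-monoʳ-≤ _ (*-monoʳ-≤ v 0≤v (draw-sizes-≤ (t ℕ.+ 0) s {S} {K} {θ = θ} 0≤η Qs goods
             (ℕ.≤-trans (ℕ.≤-reflexive (≡.cong (t ℕ.+_) (ℕ.+-identityʳ t))) 2t≤K))) ⟩
      C * D + v * ((1# + η) ^ t * C)
        ≈⟨ +-congˡ (trans (solve 3 (λ v p C → v :* (p :* C) := (v :* C) :* p) refl _ _ _)
                          (trans (*-congʳ vC≈1) (*-identityˡ _))) ⟩
      C * D + (1# + η) ^ t
        ≤⟨ +-monoʳ-≤ _ ([1+η]^-≤ t 0≤η small) ⟩
      C * D + (1# + τ)
        ≈⟨ solve 2 (λ x τ → x :+ (con 1 :+ τ) := x :+ τ :+ con 1) refl (C * D) τ ⟩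
      C * D + τ + 1# ∎)
      where
      Z : Vec ℕ n → Carrier
      Z h = fromℕ (sizes (t ℕ.+ 0) h Qs)
      tangent : ∀ h → 1# + 1# ≤ C * g (t ℕ.+ 0) h + v * Z h
      tangent h = xy≈1⇒2≤x+y (0≤x*y 0≤v (fromℕ-nonneg (sizes (t ℕ.+ 0) h Qs))) (begin-equality
        v * Z h * (C * g (t ℕ.+ 0) h)     ≈⟨ solve 4 (λ v z C g → v :* z :* (C :* g) := (v :* C) :* (g :* z)) refl _ _ _ _ ⟩
        (v * C) * (g (t ℕ.+ 0) h * Z h)   ≈⟨ *-cong vC≈1 (recip-inverseˡ (sizes (t ℕ.+ 0) h Qs)
                                               {{sizes-nonZero (t ℕ.+ 0) h Qs}}) ⟩
        1# * 1#                           ≈⟨ *-identityˡ 1# ⟩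
        1#                                ∎)

-- Empirical distributions and their oracles

module Empirical {c ℓ₁ ℓ₂ : Level} (𝔽 : OrderedField c ℓ₁ ℓ₂) (n : ℕ) .{{n≢0 : NonZero n}} where

  open OrderedFieldProperties 𝔽
  open UniformityTesting 𝔽
  open Draws 𝔽 n
  open ConditionalLaws 𝔽 n

  fromℕ-sum : ∀ {m} (h : Vec ℕ m) → (∑[ j < m ] fromℕ (lookup h j)) ≈ fromℕ (Vec.sum h)
  fromℕ-sum []      = refl
  fromℕ-sum (k ∷ h) = trans (+-congˡ (fromℕ-sum h)) (sym (fromℕ-+ k (Vec.sum h)))

  -- The empirical distribution of a multiset of S points.
  empirical : ∀ S .{{_ : NonZero S}} (h : Vec ℕ n) → Vec.sum h ≡ S → Distribution n
  empirical S h sum≡S = record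
    { pmf    = λ j → fromℕ (lookup h j) * recip S
    ; nonneg = λ j → 0≤x*y (fromℕ-nonneg (lookup h j)) (recip-nonneg S)
    ; total  = begin-equality
        (∑[ j < n ] (fromℕ (lookup h j) * recip S))  ≈⟨ *-distribʳ-sum (recip S) (fromℕ ∘ lookup h) ⟨
        (∑[ j < n ] fromℕ (lookup h j)) * recip S    ≈⟨ *-congʳ (trans (fromℕ-sum h) (reflexive (≡.cong fromℕ sum≡S))) ⟩
        fromℕ S * recip S                            ≈⟨ trans (*-comm _ _) (recip-inverseˡ S) ⟩
        1#                                           ∎
    }

  recip≈1/ : ∀ k .{{_ : NonZero k}} → recip k ≈ 1/ k
  recip≈1/ (ℕ.suc k) = refl

  χ-∈ : ∀ {A j} → j ∈ A → χ A j ≡ 1#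
  χ-∈ {A} {j} j∈A = ≡.cong (λ b → if b then 1# else 0#) ([]=⇒lookup j∈A)

  χ-∉ : ∀ {A j} → j ∉ A → χ A j ≡ 0#
  χ-∉ {A} {j} j∉A with lookup A j in eq
  ... | true  = contradiction (lookup⇒[]= j A eq) j∉A
  ... | false = ≡.refl

  -- A distribution proportional to a vector of multiplicities has decidable null
  -- queries, so its conditional oracle can be given by cases.
  module _ (μ : Distribution n) (h : Vec ℕ n) (S : ℕ) .{{_ : NonZero S}}
           (pmf≈ : ∀ j → pmf μ j ≈ fromℕ (lookup h j) * recip S) where

    mass≈ : ∀ A → mass μ A ≈ fromℕ (count A h) * recip S
    mass≈ A = begin-equality
      (∑[ j < n ] (if lookup A j then pmf μ j else 0#))
        ≈⟨ sum-cong {n} term ⟩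
      (∑[ j < n ] (χ A j * fromℕ (lookup h j) * recip S))
        ≈⟨ *-distribʳ-sum (recip S) (λ j → χ A j * fromℕ (lookup h j)) ⟨
      (∑[ j < n ] (χ A j * fromℕ (lookup h j))) * recip S
        ≈⟨ *-congʳ (fromℕ-count A h) ⟨
      fromℕ (count A h) * recip S ∎
      where
      term : ∀ j → (if lookup A j then pmf μ j else 0#) ≈ χ A j * fromℕ (lookup h j) * recip S
      term j with lookup A j
      ... | true  = trans (pmf≈ j) (*-congʳ (sym (*-identityˡ _)))
      ... | false = sym (trans (*-congʳ (zeroˡ _)) (zeroˡ _))

    oracle : ConditionalOracle μ
    oracle = record
      { law         = answer h
      ; supported   = λ (A , _) j∉A → trans (*-congʳ (reflexive (χ-∉ j∉A))) (zeroˡ _)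
      ; conditional = λ Q j∈A 0<μA → conditional′ Q j∈A 0<μA (count (proj₁ Q) h) ≡.refl
      ; null        = λ Q j∈A μA≈0 → null′ Q j∈A μA≈0 (count (proj₁ Q) h) ≡.refl
      }
      where
      mass-empty : ∀ A → count A h ≡ 0 → mass μ A ≈ 0#
      mass-empty A eq = trans (mass≈ A) (trans (*-congʳ (reflexive (≡.cong fromℕ eq))) (zeroˡ _))

      conditional′ : ∀ (Q : Query n) {j} → j ∈ proj₁ Q → (0<μA : 0# < mass μ (proj₁ Q)) →
        ∀ N → count (proj₁ Q) h ≡ N →
        pmf (answer h Q) j ≈ pmf μ j * inv (mass μ (proj₁ Q)) 0<μA
      conditional′ Q j∈A 0<μA ℕ.zero eq =
        contradiction 0<μA (<-irrefl (sym (mass-empty (proj₁ Q) eq)))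
      conditional′ Q@(A , _) {j} j∈A 0<μA N@(ℕ.suc _) eq = begin-equality
        pmf (answer h Q) j
          ≈⟨ reflexive (≡.trans (answer-nonempty h Q j {{≡.subst NonZero (≡.sym eq) _}})
               (≡.cong₂ (λ x k → x * (fromℕ (lookup h j) * recip k)) (χ-∈ j∈A) eq)) ⟩
        1# * (hⱼ * recip N)
          ≈⟨ *-congˡ (trans (*-congˡ (⁻¹-inverseʳ (mass μ A) 0<μA)) (*-identityʳ _)) ⟨
        1# * (hⱼ * recip N * (mass μ A * i))
          ≈⟨ *-congˡ (*-congˡ (*-congʳ (trans (mass≈ A) (*-congʳ (reflexive (≡.cong fromℕ eq)))))) ⟩
        1# * (hⱼ * recip N * (fromℕ N * recip S * i))
          ≈⟨ solve 5 (λ h r N s i → con 1 :* (h :* r :* (N :* s :* i)) := r :* N :* (h :* s :* i)) refl _ _ _ _ _ ⟩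
        recip N * fromℕ N * (hⱼ * recip S * i)
          ≈⟨ trans (*-congʳ (recip-inverseˡ N)) (*-identityˡ _) ⟩
        hⱼ * recip S * i
          ≈⟨ *-congʳ (pmf≈ j) ⟨
        pmf μ j * i ∎
        where
        hⱼ = fromℕ (lookup h j)
        i = inv (mass μ A) 0<μA

      null′ : ∀ (Q : Query n) {j} → j ∈ proj₁ Q → mass μ (proj₁ Q) ≈ 0# →
        ∀ N → count (proj₁ Q) h ≡ N →
        pmf (answer h Q) j ≈ (1/ ∣ proj₁ Q ∣) {{queryNonZero Q}}
      null′ Q@(A , _) {j} j∈A μA≈0 ℕ.zero eq = begin-equality
        pmf (answer h Q) j                  ≈⟨ reflexive (answer-empty h Q j eq) ⟩
        pmf (uniformAnswer Q) j             ≈⟨ pmf-uniformAnswer Q j ⟩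
        χ A j * recip (count A ones)        ≈⟨ trans (*-congʳ (reflexive (χ-∈ j∈A))) (*-identityˡ _) ⟩
        recip (count A ones)                ≈⟨ reflexive (≡.cong recip (count-ones A)) ⟩
        recip ∣ A ∣                         ≈⟨ recip≈1/ ∣ A ∣ {{queryNonZero Q}} ⟩
        (1/ ∣ A ∣) {{queryNonZero Q}}       ∎
      null′ Q@(A , _) j∈A μA≈0 N@(ℕ.suc _) eq = contradiction 0<1 (<-irrefl (sym (begin-equality
        1#                                              ≈⟨ *-identityˡ 1# ⟨
        1# * 1#                                         ≈⟨ *-cong (recip-inverseˡ N) (recip-inverseˡ S) ⟨
        recip N * fromℕ N * (recip S * fromℕ S)
          ≈⟨ solve 4 (λ r N s S → r :* N :* (s :* S) := r :* S :* (N :* s)) refl _ _ _ _ ⟩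
        recip N * fromℕ S * (fromℕ N * recip S)
          ≈⟨ *-congˡ (trans (sym (trans (mass≈ A) (*-congʳ (reflexive (≡.cong fromℕ eq))))) μA≈0) ⟩
        recip N * fromℕ S * 0#                          ≈⟨ zeroʳ _ ⟩
        0#                                              ∎)))

  uniformOracle : ConditionalOracle (uniform n)
  uniformOracle = oracle (uniform n) ones n λ j → begin-equality
    1/ n                             ≈⟨ recip≈1/ n ⟨
    recip n                          ≈⟨ trans (*-congʳ fromℕ-1) (*-identityˡ _) ⟨
    fromℕ 1 * recip n                ≈⟨ reflexive (≡.cong (λ k → fromℕ k * recip n) (lookup-ones j)) ⟨
    fromℕ (lookup ones j) * recip n  ∎

  empiricalOracle : ∀ S .{{_ : NonZero S}} h (eq : Vec.sum h ≡ S) → ConditionalOracle (empirical S h eq)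
  empiricalOracle S h eq = oracle (empirical S h eq) h S λ j → refl

  x≤∣x∣ : ∀ x → x ≤ ∣ x ∣ₐ
  x≤∣x∣ x = proj₁ (∨-supremum x (- x))

  -x≤∣x∣ : ∀ x → - x ≤ ∣ x ∣ₐ
  -x≤∣x∣ x = proj₁ (proj₂ (∨-supremum x (- x)))

  0≤∣x∣ : ∀ x → 0# ≤ ∣ x ∣ₐ
  0≤∣x∣ x = ≤-cases 0# x (λ 0≤x → ≤-trans 0≤x (x≤∣x∣ x)) λ x≤0 →
    ≤-trans (≤-trans (x≤y⇒0≤y-x x≤0) (≤-reflexive (+-identityˡ (- x)))) (-x≤∣x∣ x)

  -- At least n - S points have no mass under an empirical distribution of S
  -- points, and each of them contributes 1/n.
  empirical-far : ∀ S .{{_ : NonZero S}} h (eq : Vec.sum h ≡ S) → S ℕ.+ S ℕ.≤ n →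
    fromℚ (+ 1 / 4) ≤ variationDistance (empirical S h eq) (uniform n)
  empirical-far S h eq 2S≤n = begin
    fromℕ 1 * (1/ 4)                    ≈⟨ trans (*-congʳ fromℕ-1) (*-identityˡ _) ⟩
    1/ 4                                ≈⟨ *-identityʳ _ ⟨
    (1/ 4) * 1#                         ≤⟨ *-monoʳ-≤ _ (1/-nonneg 4) 1≤Δ+Δ ⟩
    (1/ 4) * (Δ + Δ)                    ≈⟨ *-identityˡ _ ⟨
    1# * ((1/ 4) * (Δ + Δ))             ≈⟨ *-congʳ (1/-inverseˡ 2) ⟨
    (1/ 2) * fromℕ 2 * ((1/ 4) * (Δ + Δ))
      ≈⟨ *-congʳ (*-congˡ (+-congˡ fromℕ-1)) ⟩
    (1/ 2) * (1# + 1#) * ((1/ 4) * (Δ + Δ))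
      ≈⟨ solve 3 (λ h q Δ → h :* (con 1 :+ con 1) :* (q :* (Δ :+ Δ)) := q :* (con 1 :+ (con 1 :+ (con 1 :+ con 1))) :* (h :* Δ)) refl _ _ _ ⟩
    (1/ 4) * (1# + (1# + (1# + 1#))) * ((1/ 2) * Δ)
      ≈⟨ *-congʳ (*-congˡ (+-congˡ (+-congˡ (+-congˡ fromℕ-1)))) ⟨
    (1/ 4) * fromℕ 4 * ((1/ 2) * Δ)     ≈⟨ trans (*-congʳ (1/-inverseˡ 4)) (*-identityˡ _) ⟩
    (1/ 2) * Δ                          ∎
    where
    gap : Fin n → Carrier
    gap j = fromℕ (lookup h j) * recip S - (1/ n)
    Δ = ∑[ j < n ] ∣ gap j ∣ₐ

    -- A term with k = 0 contributes 1/n, and for k ≥ 1 the second summand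
    -- is already at least 1/n.
    pointwise : ∀ k → (1/ n) ≤ ∣ fromℕ k * recip S - (1/ n) ∣ₐ + fromℕ k * (1/ n)
    pointwise ℕ.zero = begin
      1/ n                                         ≈⟨ -‿involutive _ ⟨
      - - (1/ n)                                   ≈⟨ -‿cong (trans (+-congʳ (zeroˡ _)) (+-identityˡ _)) ⟨
      - (0# * recip S - (1/ n))                    ≤⟨ -x≤∣x∣ _ ⟩
      ∣ 0# * recip S - (1/ n) ∣ₐ                   ≈⟨ trans (+-congˡ (zeroˡ _)) (+-identityʳ _) ⟨
      ∣ 0# * recip S - (1/ n) ∣ₐ + 0# * (1/ n)     ∎
    pointwise (ℕ.suc k) = ≤-+ˡ _ (0≤∣x∣ _) (begin
      1/ n                          ≤⟨ ≤-+ʳ _ (0≤x*y (fromℕ-nonneg k) (1/-nonneg n)) ≤-refl ⟩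
      (1/ n) + fromℕ k * (1/ n)     ≈⟨ +-congʳ (*-identityˡ _) ⟨
      1# * (1/ n) + fromℕ k * (1/ n)  ≈⟨ distribʳ _ _ _ ⟨
      fromℕ (ℕ.suc k) * (1/ n)      ∎)

    1≤Δ+S/n : 1# ≤ Δ + fromℕ S * (1/ n)
    1≤Δ+S/n = begin
      1#
        ≈⟨ total (uniform n) ⟨
      (∑[ j < n ] (1/ n))
        ≤⟨ sum-mono-≤ {n} (λ j → pointwise (lookup h j)) ⟩
      (∑[ j < n ] (∣ gap j ∣ₐ + fromℕ (lookup h j) * (1/ n)))
        ≈⟨ ∑-distrib-+ {n} (λ j → ∣ gap j ∣ₐ) (λ j → fromℕ (lookup h j) * (1/ n)) ⟩
      Δ + (∑[ j < n ] (fromℕ (lookup h j) * (1/ n)))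
        ≈⟨ +-congˡ (trans (sym (*-distribʳ-sum (1/ n) (fromℕ ∘ lookup h)))
             (*-congʳ (trans (fromℕ-sum h) (reflexive (≡.cong fromℕ eq))))) ⟩
      Δ + fromℕ S * (1/ n) ∎

    1≤Δ+Δ : 1# ≤ Δ + Δ
    1≤Δ+Δ = +-cancelʳ-≤ 1# (begin
      1# + 1#                                             ≤⟨ +-mono-≤ 1≤Δ+S/n 1≤Δ+S/n ⟩
      (Δ + fromℕ S * (1/ n)) + (Δ + fromℕ S * (1/ n))
        ≈⟨ solve 3 (λ Δ s ι → (Δ :+ s :* ι) :+ (Δ :+ s :* ι) := Δ :+ Δ :+ (s :+ s) :* ι) refl _ _ _ ⟩
      Δ + Δ + (fromℕ S + fromℕ S) * (1/ n)                ≈⟨ +-congˡ (*-congʳ (fromℕ-+ S S)) ⟨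
      Δ + Δ + fromℕ (S ℕ.+ S) * (1/ n)                    ≤⟨ +-monoʳ-≤ _ (*-monoˡ-≤ _ (1/-nonneg n) (fromℕ-mono-≤ 2S≤n)) ⟩
      Δ + Δ + fromℕ n * (1/ n)                            ≈⟨ +-congˡ (⁻¹-inverseʳ (fromℕ n) (fromℕ-pos n)) ⟩
      Δ + Δ + 1#                                          ∎)

-- Scales and averaging

-- The parameters, for a bound q on the number of queries: an error of order
-- 1/L is allowed per query, P is the ratio that separates big from small queries,
-- and R is the ratio of consecutive scales.
module Scales (q : ℕ) .{{q≢0 : NonZero q}} where

  L P R : ℕ
  L = 32 ℕ.* q
  P = L ℕ.* (q ℕ.+ q)
  R = P ℕ.* P

  -- Indexed from k = 0, so the first K scales end with R ^ K.
  scale : ℕ → ℕ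
  scale k = R ℕ.^ ℕ.suc k

  2q-nonZero : NonZero (q ℕ.+ q)
  2q-nonZero = ℕ.>-nonZero (ℕ.≤-trans (ℕ.>-nonZero⁻¹ q) (ℕ.m≤m+n q q))

  L-nonZero : NonZero L
  L-nonZero = ℕ.m*n≢0 32 q

  P-nonZero : NonZero P
  P-nonZero = ℕ.m*n≢0 L (q ℕ.+ q) {{L-nonZero}} {{2q-nonZero}}

  R-nonZero : NonZero R
  R-nonZero = ℕ.m*n≢0 P P {{P-nonZero}} {{P-nonZero}}

  scale-nonZero : ∀ k → NonZero (scale k)
  scale-nonZero k = ℕ.m^n≢0 R (ℕ.suc k) {{R-nonZero}}

  L≤P : L ℕ.≤ P
  L≤P = ℕ.m≤m*n L (q ℕ.+ q) {{2q-nonZero}}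

  q≤scale : ∀ k → q ℕ.≤ scale k
  q≤scale k = begin
    q         ≤⟨ ℕ.m≤n*m q 32 ⟩
    L         ≤⟨ L≤P ⟩
    P         ≤⟨ ℕ.m≤m*n P P {{P-nonZero}} ⟩
    R         ≤⟨ ℕ.m≤m*n R (R ℕ.^ k) {{ℕ.m^n≢0 R k {{R-nonZero}}}} ⟩
    scale k   ∎
    where open ℕ.≤-Reasoning

  scale-≤ : ∀ {k K} → k ℕ.< K → scale k ℕ.≤ R ℕ.^ K
  scale-≤ k<K = ℕ.^-monoʳ-≤ R {{R-nonZero}} k<K

  -- A subset of [n] with a elements is neither big nor small at the scale with
  -- index k.
  Bad : ℕ → ℕ → ℕ → Set
  Bad n a k = scale k ℕ.* a ℕ.< P ℕ.* n × n ℕ.< P ℕ.* (scale k ℕ.* a)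

  bad? : ∀ n a k → Dec (Bad n a k)
  bad? n a k = (scale k ℕ.* a ℕ.<? P ℕ.* n) ×-dec (n ℕ.<? P ℕ.* (scale k ℕ.* a))

  -- If a set is not small at one scale, then it is big at every later one,
  -- as R = P².
  Bad-< : ∀ {n a i j} → Bad n a i → Bad n a j → ¬ i ℕ.< j
  Bad-< {n} {a} {i} {j} (_ , n<Psᵢa) (sⱼa<Pn , _) i<j = ℕ.<-irrefl ≡.refl (begin-strict
    P ℕ.* n                          <⟨ ℕ.*-monoʳ-< P {{P-nonZero}} n<Psᵢa ⟩
    P ℕ.* (P ℕ.* (scale i ℕ.* a))    ≡⟨ regroup P (scale i) a ⟩
    R ℕ.* scale i ℕ.* a              ≤⟨ ℕ.*-monoˡ-≤ a (ℕ.^-monoʳ-≤ R {{R-nonZero}} (ℕ.s≤s i<j)) ⟩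
    scale j ℕ.* a                    <⟨ sⱼa<Pn ⟩
    P ℕ.* n                          ∎)
    where
    open ℕ.≤-Reasoning
    regroup : ∀ p s a → p ℕ.* (p ℕ.* (s ℕ.* a)) ≡ p ℕ.* p ℕ.* s ℕ.* a
    regroup = solve-∀

  Bad-unique : ∀ {n a i j} → Bad n a i → Bad n a j → i ≡ j
  Bad-unique {i = i} {j} badᵢ badⱼ with ℕ.<-cmp i j
  ... | tri≈ _ i≡j _ = i≡j
  ... | tri< i<j _ _ = contradiction i<j (Bad-< badᵢ badⱼ)
  ... | tri> _ _ j<i = contradiction j<i (Bad-< badⱼ badᵢ)

  -- The contradiction reached for K = 8q scales.
  too-few : ∀ {t} → t ℕ.< q → ¬ 24 ℕ.* (8 ℕ.* q) ℕ.≤ 19 ℕ.* (8 ℕ.* q) ℕ.+ 24 ℕ.* t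
  too-few {t} t<q 24K≤19K+24t = ℕ.<-irrefl ≡.refl (begin-strict
    40 ℕ.* q         ≤⟨ ℕ.+-cancelˡ-≤ (19 ℕ.* (8 ℕ.* q)) _ _ (ℕ.≤-trans (ℕ.≤-reflexive (split q)) 24K≤19K+24t) ⟩
    24 ℕ.* t         ≤⟨ ℕ.*-monoʳ-≤ 24 (ℕ.<⇒≤ t<q) ⟩
    24 ℕ.* q         <⟨ ℕ.*-monoˡ-< q (ℕ.m≤m+n 25 15) ⟩
    40 ℕ.* q         ∎)
    where
    open ℕ.≤-Reasoning
    split : ∀ q → 19 ℕ.* (8 ℕ.* q) ℕ.+ 40 ℕ.* q ≡ 24 ℕ.* (8 ℕ.* q)
    split = solve-∀

module Averaging {c ℓ₁ ℓ₂ : Level} (𝔽 : OrderedField c ℓ₁ ℓ₂) (n : ℕ) .{{n≢0 : NonZero n}}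
                 (q : ℕ) .{{q≢0 : NonZero q}} where

  open OrderedFieldProperties 𝔽
  open UniformityTesting 𝔽
  open Draws 𝔽 n
  open Expectations 𝔽
  open ConditionalLaws 𝔽 n
  open Empirical 𝔽 n
  open Scales q

  -- The indicator of a decidable property.
  indicator : ∀ {p} {X : Set p} → Dec X → Carrier
  indicator X? = if does X? then 1# else 0#

  indicator-nonneg : ∀ {p} {X : Set p} (X? : Dec X) → 0# ≤ indicator X?
  indicator-nonneg (yes _) = 0≤1
  indicator-nonneg (no  _) = ≤-refl

  1≤indicator : ∀ {p} {X : Set p} (X? : Dec X) → X → 1# ≤ indicator X?
  1≤indicator (yes _) x = ≤-refl
  1≤indicator (no ¬x) x = contradiction x ¬x

  ∑-indicator-≤1 : ∀ {K p} {X : Fin K → Set p} (X? : ∀ i → Dec (X i)) →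
                   (∀ {i j} → X i → X j → i ≡ j) → (∑[ i < K ] indicator (X? i)) ≤ 1#
  ∑-indicator-≤1 {ℕ.zero}  X? unique = 0≤1
  ∑-indicator-≤1 {ℕ.suc K} X? unique with X? Fin.zero
  ... | no  _  = ≤-trans (≤-reflexive (+-identityˡ _))
                   (∑-indicator-≤1 (X? ∘ Fin.suc) (λ x y → Fin.suc-injective (unique x y)))
  ... | yes x₀ = ≤-reflexive (trans (+-congˡ (trans (sum-cong {K} others) (sum-replicate-zero K)))
                                    (+-identityʳ 1#))
    where
    others : ∀ i → indicator (X? (Fin.suc i)) ≈ 0#
    others i with X? (Fin.suc i)
    ... | no  _ = refl
    ... | yes x = contradiction (unique x₀ x) λ ()

  size : Query n → ℕ
  size Q = count (proj₁ Q) ones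

  big : ℕ → Query n → Bool
  big k Q = does (P ℕ.* n ℕ.≤? scale k ℕ.* size Q)

  -- The number of queries that are bad at the scale with index k.
  badness : ∀ {t} → ℕ → Vec (Query n) t → Carrier
  badness k []       = 0#
  badness k (Q ∷ Qs) = indicator (bad? n (size Q) k) + badness k Qs

  badness-nonneg : ∀ {t} k (Qs : Vec (Query n) t) → 0# ≤ badness k Qs
  badness-nonneg k []       = ≤-refl
  badness-nonneg k (Q ∷ Qs) = 0≤x+y (indicator-nonneg (bad? n (size Q) k)) (badness-nonneg k Qs)

  ∑-badness-≤ : ∀ {t} K (Qs : Vec (Query n) t) → (∑[ k < K ] badness (Fin.toℕ k) Qs) ≤ fromℕ t
  ∑-badness-≤ K []       = ≤-reflexive (sum-replicate-zero K)
  ∑-badness-≤ K (Q ∷ Qs) = ≤-trans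
    (≤-reflexive (∑-distrib-+ {K} (λ k → indicator (bad? n (size Q) (Fin.toℕ k))) (λ k → badness (Fin.toℕ k) Qs)))
    (+-mono-≤ (∑-indicator-≤1 {K} (λ k → bad? n (size Q) (Fin.toℕ k))
                (λ x y → Fin.toℕ-injective (Bad-unique {n} {size Q} x y)))
              (∑-badness-≤ K Qs))

  -- The unit of error: η = ι for big queries and θ = ι + ι for small ones.
  ι : Carrier
  ι = recip L

  ιL≈1 : ι * fromℕ L ≈ 1#
  ιL≈1 = recip-inverseˡ L {{L-nonZero}}

  0≤ι : 0# ≤ ι
  0≤ι = recip-nonneg L

  fromℕ-density : ∀ s Q → density s (proj₁ Q) ≈ fromℕ (s ℕ.* size Q) * (1/ n)
  fromℕ-density s Q = trans (sym (*-assoc _ _ _)) (*-congʳ (sym (fromℕ-* s (size Q))))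

  n/n≈1 : fromℕ n * (1/ n) ≈ 1#
  n/n≈1 = ⁻¹-inverseʳ (fromℕ n) (fromℕ-pos n)

  module _ {t : ℕ} (t<q : t ℕ.< q) (k : ℕ) where

    open GoodScale 𝔽 n (big k)

    -- τ bounds the loss from the big queries, and σ that from all queries.
    τ σ : Carrier
    τ = fromℕ t * (ι + ι)
    σ = τ + τ

    -- The quality of queries that is required at this scale.
    Fine : Query n → Set _
    Fine = Good (scale k) (t ℕ.+ scale k) (t ℕ.+ t) ι (ι + ι)

    big⇒ : ∀ Q → P ℕ.* n ℕ.≤ scale k ℕ.* size Q → fromℕ (t ℕ.+ t) ≤ ι * density (scale k) (proj₁ Q)
    big⇒ Q Pn≤sa = begin
      fromℕ (t ℕ.+ t)                            ≤⟨ fromℕ-mono-≤ (ℕ.+-mono-≤ (ℕ.<⇒≤ t<q) (ℕ.<⇒≤ t<q)) ⟩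
      fromℕ (q ℕ.+ q)                            ≈⟨ trans (*-congʳ ιL≈1) (*-identityˡ _) ⟨
      ι * fromℕ L * fromℕ (q ℕ.+ q)              ≈⟨ trans (*-assoc _ _ _) (*-congˡ (sym (fromℕ-* L (q ℕ.+ q)))) ⟩
      ι * fromℕ P                                ≈⟨ *-congˡ (trans (*-congˡ n/n≈1) (*-identityʳ _)) ⟨
      ι * (fromℕ P * (fromℕ n * (1/ n)))         ≈⟨ *-congˡ (trans (*-congʳ (fromℕ-* P n)) (*-assoc _ _ _)) ⟨
      ι * (fromℕ (P ℕ.* n) * (1/ n))             ≤⟨ *-monoʳ-≤ ι 0≤ι (*-monoˡ-≤ _ (1/-nonneg n) (fromℕ-mono-≤ Pn≤sa)) ⟩
      ι * (fromℕ (scale k ℕ.* size Q) * (1/ n))  ≈⟨ *-congˡ (fromℕ-density (scale k) Q) ⟨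
      ι * density (scale k) (proj₁ Q)            ∎

    small⇒ : ∀ Q → P ℕ.* (scale k ℕ.* size Q) ℕ.≤ n → density (t ℕ.+ scale k) (proj₁ Q) ≤ ι + ι
    small⇒ Q Psa≤n = begin
      density (t ℕ.+ scale k) (proj₁ Q)
        ≤⟨ *-monoˡ-≤ _ (0≤x*y (fromℕ-nonneg (size Q)) (1/-nonneg n))
             (≤-trans (fromℕ-mono-≤ (ℕ.+-monoˡ-≤ (scale k) (ℕ.≤-trans (ℕ.<⇒≤ t<q) (q≤scale k))))
                      (≤-reflexive (fromℕ-+ (scale k) (scale k)))) ⟩
      (fromℕ (scale k) + fromℕ (scale k)) * (fromℕ (size Q) * (1/ n))
        ≈⟨ distribʳ _ _ _ ⟩
      density (scale k) (proj₁ Q) + density (scale k) (proj₁ Q)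
        ≤⟨ +-mono-≤ single single ⟩
      ι + ι ∎
      where
      single : density (scale k) (proj₁ Q) ≤ ι
      single = begin
        density (scale k) (proj₁ Q)                     ≈⟨ fromℕ-density (scale k) Q ⟩
        fromℕ (scale k ℕ.* size Q) * (1/ n)             ≈⟨ trans (*-congʳ ιL≈1) (*-identityˡ _) ⟨
        ι * fromℕ L * (fromℕ (scale k ℕ.* size Q) * (1/ n))
          ≈⟨ solve 4 (λ i l x y → i :* l :* (x :* y) := i :* (l :* x :* y)) refl _ _ _ _ ⟩
        ι * (fromℕ L * fromℕ (scale k ℕ.* size Q) * (1/ n))
          ≈⟨ *-congˡ (*-congʳ (fromℕ-* L (scale k ℕ.* size Q))) ⟨
        ι * (fromℕ (L ℕ.* (scale k ℕ.* size Q)) * (1/ n))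
          ≤⟨ *-monoʳ-≤ ι 0≤ι (*-monoˡ-≤ _ (1/-nonneg n) (fromℕ-mono-≤
               (ℕ.≤-trans (ℕ.*-monoˡ-≤ (scale k ℕ.* size Q) L≤P) Psa≤n))) ⟩
        ι * (fromℕ n * (1/ n))                          ≈⟨ trans (*-congˡ n/n≈1) (*-identityʳ ι) ⟩
        ι                                               ∎

    fine⊎bad : ∀ {m} (Qs : Vec (Query n) m) → All Fine Qs ⊎ (1# ≤ badness k Qs)
    fine⊎bad []       = inj₁ []
    fine⊎bad (Q ∷ Qs) with fine⊎bad Qs
    ... | inj₂ 1≤b = inj₂ (≤-+ˡ _ (indicator-nonneg (bad? n (size Q) k)) 1≤b)
    ... | inj₁ fs with bad? n (size Q) k
    ...   | yes isBad = inj₂ (≤-+ʳ _ (badness-nonneg k Qs) (1≤indicator (bad? n (size Q) k) isBad))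
    ...   | no ¬isBad with P ℕ.* n ℕ.≤? scale k ℕ.* size Q in eq
    ...     | yes Pn≤sa = inj₁ (inj₁ (≡.cong does eq , big⇒ Q Pn≤sa) ∷ fs)
    ...     | no  Pn≰sa = inj₁ (inj₂ (≡.cong does eq ,
                            small⇒ Q (ℕ.≮⇒≥ λ n<Psa → ¬isBad (ℕ.≰⇒> Pn≰sa , n<Psa))) ∷ fs)

    16τ≤1 : fromℕ 16 * τ ≤ 1#
    16τ≤1 = begin
      fromℕ 16 * (fromℕ t * (ι + ι))          ≈⟨ solve 3 (λ s t i → s :* (t :* (i :+ i)) := i :* (s :* t :+ s :* t)) refl _ _ _ ⟩
      ι * (fromℕ 16 * fromℕ t + fromℕ 16 * fromℕ t)
        ≈⟨ *-congˡ (trans (fromℕ-+ (16 ℕ.* t) (16 ℕ.* t)) (+-cong (fromℕ-* 16 t) (fromℕ-* 16 t))) ⟨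
      ι * fromℕ (16 ℕ.* t ℕ.+ 16 ℕ.* t)       ≤⟨ *-monoʳ-≤ ι 0≤ι (fromℕ-mono-≤ (ℕ.≤-trans
                                                   (ℕ.≤-reflexive (≡.sym (ℕ.*-distribʳ-+ t 16 16))) (ℕ.*-monoʳ-≤ 32 (ℕ.<⇒≤ t<q)))) ⟩
      ι * fromℕ L                             ≈⟨ ιL≈1 ⟩
      1#                                      ∎

    0≤τ : 0# ≤ τ
    0≤τ = 0≤x*y (fromℕ-nonneg t) (0≤x+y 0≤ι 0≤ι)

    τ≤1 : τ ≤ 1#
    τ≤1 = begin
      τ               ≈⟨ trans (*-congʳ fromℕ-1) (*-identityˡ τ) ⟨
      fromℕ 1 * τ     ≤⟨ *-monoˡ-≤ τ 0≤τ (fromℕ-mono-≤ {1} {16} (ℕ.s≤s ℕ.z≤n)) ⟩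
      fromℕ 16 * τ    ≤⟨ 16τ≤1 ⟩
      1#              ∎

    8σ≤1 : fromℕ 8 * σ ≤ 1#
    8σ≤1 = begin
      fromℕ 8 * (τ + τ)            ≈⟨ solve 2 (λ e τ → e :* (τ :+ τ) := (e :+ e) :* τ) refl _ _ ⟩
      (fromℕ 8 + fromℕ 8) * τ      ≈⟨ *-congʳ (fromℕ-+ 8 8) ⟨
      fromℕ 16 * τ                 ≤⟨ 16τ≤1 ⟩
      1#                           ∎

    -- At a scale that is not good the number of bad queries makes the bound
    -- trivial.
    uniform-≤-draw+badness : (Qs : Vec (Query n) t) (f : Vec (Fin n) t → Carrier) →
      (∀ js → 0# ≤ f js) → (∀ js → f js ≤ 1#) →
      𝔼 (Vec.map uniformAnswer Qs) f ≤
      draw (t ℕ.+ scale k) (λ h → 𝔼 (Vec.map (answer h) Qs) f) + (badness k Qs + σ)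
    uniform-≤-draw+badness Qs f 0≤f f≤1 with fine⊎bad Qs
    ... | inj₁ fine = ≤-trans
      (uniform-≤-draw (scale k) {{scale-nonZero k}} {t ℕ.+ t} 0≤ι (0≤x+y 0≤ι 0≤ι) τ≤1 ℕ.≤-refl Qs fine f 0≤f f≤1)
      (+-monoʳ-≤ _ (≤-+ˡ _ (badness-nonneg k Qs) ≤-refl))
    ... | inj₂ 1≤b = begin
      𝔼 (Vec.map uniformAnswer Qs) f
        ≤⟨ 𝔼-mono (Vec.map uniformAnswer Qs) f≤1 ⟩
      𝔼 (Vec.map uniformAnswer Qs) (λ _ → 1#)
        ≈⟨ 𝔼-const (Vec.map uniformAnswer Qs) 1# ⟩
      1#
        ≤⟨ ≤-+ˡ _ (draw-nonneg (t ℕ.+ scale k) (λ h → 𝔼-nonneg (Vec.map (answer h) Qs) 0≤f))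
             (≤-+ʳ _ (0≤x+y 0≤τ 0≤τ) 1≤b) ⟩
      draw (t ℕ.+ scale k) (λ h → 𝔼 (Vec.map (answer h) Qs) f) + (badness k Qs + σ) ∎

  module _ {t : ℕ} (t<q : t ℕ.< q) (large : 4 ℕ.* R ℕ.^ (8 ℕ.* q) ℕ.≤ n)
           (T : NonAdaptiveTester n t)
           (isTester : IsUniformityTester (fromℚ (+ 1 / 4)) (fromℚ (+ 1 / 3)) T) where

    open NonAdaptiveTester T
    open IsUniformityTester isTester

    K : ℕ
    K = 8 ℕ.* q

    δ : Carrier
    δ = fromℚ (+ 1 / 3)

    p : Fin outcomes → Carrier
    p = pmf coins

    accept reject : Fin outcomes → Vec (Fin n) t → Carrier
    accept r js = if accepts r js then 1# else 0#
    reject r js = if not (accepts r js) then 1# else 0#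

    0≤accept : ∀ r js → 0# ≤ accept r js
    0≤accept r js with accepts r js
    ... | true  = 0≤1
    ... | false = ≤-refl

    accept≤1 : ∀ r js → accept r js ≤ 1#
    accept≤1 r js with accepts r js
    ... | true  = ≤-refl
    ... | false = 0≤1

    accept+reject : ∀ r js → accept r js + reject r js ≈ 1#
    accept+reject r js with accepts r js
    ... | true  = +-identityʳ 1#
    ... | false = +-identityˡ 1#

    -- The acceptance and rejection probabilities on the instance h for fixed
    -- coins.
    X Y : Fin outcomes → Vec ℕ n → Carrier
    X r h = 𝔼 (Vec.map (answer h) (queries r)) (accept r)
    Y r h = 𝔼 (Vec.map (answer h) (queries r)) (reject r)

    -- The acceptance probability on the instance h.
    acceptance : Vec ℕ n → Carrier
    acceptance h = ∑[ r < outcomes ] (p r * X r h)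

    -- The number of points drawn at the scale with index k.
    S : ℕ → ℕ
    S k = t ℕ.+ scale k

    S-nonZero : ∀ k → NonZero (S k)
    S-nonZero k = ℕ.>-nonZero (ℕ.≤-trans (ℕ.>-nonZero⁻¹ (scale k) {{scale-nonZero k}}) (ℕ.m≤n+m (scale k) t))

    2S≤n : ∀ {k} → k ℕ.< K → S k ℕ.+ S k ℕ.≤ n
    2S≤n {k} k<K = ℕ.≤-trans (ℕ.+-mono-≤ S≤ S≤) (ℕ.≤-trans (ℕ.≤-reflexive (four (R ℕ.^ K))) large)
      where
      S≤ : S k ℕ.≤ R ℕ.^ K ℕ.+ R ℕ.^ K
      S≤ = ℕ.+-mono-≤ (ℕ.≤-trans (ℕ.<⇒≤ t<q) (ℕ.≤-trans (q≤scale k) (scale-≤ k<K))) (scale-≤ k<K)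
      four : ∀ x → (x ℕ.+ x) ℕ.+ (x ℕ.+ x) ≡ 4 ℕ.* x
      four = solve-∀

    acceptance-≤ : ∀ {k} → k ℕ.< K → ∀ h → Vec.sum h ≡ S k → acceptance h ≤ δ
    acceptance-≤ {k} k<K h eq = +-cancelʳ-≤ (1# - δ) (begin
      acceptance h + (1# - δ)
        ≤⟨ +-monoʳ-≤ _ (sound (empirical (S k) {{S-nonZero k}} h eq)
             (empirical-far (S k) {{S-nonZero k}} h eq (2S≤n k<K))
             (empiricalOracle (S k) {{S-nonZero k}} h eq)) ⟩
      acceptance h + (∑[ r < outcomes ] (p r * Y r h))
        ≈⟨ mean-+ coins (λ r → X r h) (λ r → Y r h) ⟨
      (∑[ r < outcomes ] (p r * (X r h + Y r h)))
        ≈⟨ sum-cong {outcomes} (λ r → *-congˡ (X+Y≈1 r)) ⟩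
      (∑[ r < outcomes ] (p r * 1#))
        ≈⟨ mean-const coins 1# ⟩
      1#
        ≈⟨ y-x+x≈y δ 1# ⟨
      (1# - δ) + δ
        ≈⟨ +-comm _ _ ⟩
      δ + (1# - δ) ∎)
      where
      X+Y≈1 : ∀ r → X r h + Y r h ≈ 1#
      X+Y≈1 r = begin-equality
        X r h + Y r h
          ≈⟨ 𝔼-+ (Vec.map (answer h) (queries r)) (accept r) (reject r) ⟨
        𝔼 (Vec.map (answer h) (queries r)) (λ js → accept r js + reject r js)
          ≈⟨ 𝔼-cong (Vec.map (answer h) (queries r)) (accept+reject r) ⟩
        𝔼 (Vec.map (answer h) (queries r)) (λ _ → 1#)
          ≈⟨ 𝔼-const (Vec.map (answer h) (queries r)) 1# ⟩
        1# ∎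

    -- For fixed coins: the acceptance probability on the uniform distribution, and
    -- the sum over the scales of that on a random hard instance.
    U D : Fin outcomes → Carrier
    U r = 𝔼 (Vec.map uniformAnswer (queries r)) (accept r)
    D r = ∑[ k < K ] draw (S (Fin.toℕ k)) (X r)

    -- The loss does not depend on the scale, so the index 0 is arbitrary.
    σ₀ : Carrier
    σ₀ = σ t<q 0

    per-outcome : ∀ r → fromℕ K * U r ≤ D r + (fromℕ t + fromℕ K * σ₀)
    per-outcome r = begin
      fromℕ K * U r
        ≈⟨ sum-const K (U r) ⟨
      (∑[ k < K ] U r)
        ≤⟨ sum-mono-≤ {K} (λ k → uniform-≤-draw+badness t<q (Fin.toℕ k) (queries r) (accept r) (0≤accept r) (accept≤1 r)) ⟩
      (∑[ k < K ] (draw (S (Fin.toℕ k)) (X r) + (badness (Fin.toℕ k) (queries r) + σ₀)))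
        ≈⟨ ∑-distrib-+ {K} (λ k → draw (S (Fin.toℕ k)) (X r)) (λ k → badness (Fin.toℕ k) (queries r) + σ₀) ⟩
      D r + (∑[ k < K ] (badness (Fin.toℕ k) (queries r) + σ₀))
        ≈⟨ +-congˡ (∑-distrib-+ {K} (λ k → badness (Fin.toℕ k) (queries r)) (λ _ → σ₀)) ⟩
      D r + ((∑[ k < K ] badness (Fin.toℕ k) (queries r)) + (∑[ k < K ] σ₀))
        ≤⟨ +-monoʳ-≤ _ (+-mono-≤ (∑-badness-≤ K (queries r)) (≤-reflexive (sum-const K σ₀))) ⟩
      D r + (fromℕ t + fromℕ K * σ₀) ∎

    ∑-D-≤ : (∑[ r < outcomes ] (p r * D r)) ≤ fromℕ K * δ
    ∑-D-≤ = begin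
      (∑[ r < outcomes ] (p r * D r))
        ≈⟨ sum-cong {outcomes} (λ r → *-distribˡ-sum {K} (p r) (λ k → draw (S (Fin.toℕ k)) (X r))) ⟩
      (∑[ r < outcomes ] ∑[ k < K ] (p r * draw (S (Fin.toℕ k)) (X r)))
        ≈⟨ ∑-comm {outcomes} {K} (λ r k → p r * draw (S (Fin.toℕ k)) (X r)) ⟩
      (∑[ k < K ] ∑[ r < outcomes ] (p r * draw (S (Fin.toℕ k)) (X r)))
        ≤⟨ sum-mono-≤ {K} (λ k → at-scale (Fin.toℕ k) (Fin.toℕ<n k)) ⟩
      (∑[ k < K ] δ)
        ≈⟨ sum-const K δ ⟩
      fromℕ K * δ ∎
      where
      at-scale : ∀ k → k ℕ.< K → (∑[ r < outcomes ] (p r * draw (S k) (X r))) ≤ δ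
      at-scale k k<K = begin
        (∑[ r < outcomes ] (p r * draw (S k) (X r)))
          ≈⟨ sum-cong {outcomes} (λ r → draw-* (S k) (p r) (X r)) ⟨
        (∑[ r < outcomes ] draw (S k) (λ h → p r * X r h))
          ≈⟨ draw-∑ (S k) (λ r h → p r * X r h) ⟨
        draw (S k) acceptance
          ≤⟨ draw-mono-on (S k) (acceptance-≤ k<K) ⟩
        draw (S k) (λ _ → δ)
          ≈⟨ draw-const (S k) δ ⟩
        δ ∎

    averaged : fromℕ K ≤ fromℕ K * δ + fromℕ K * δ + (fromℕ t + fromℕ K * σ₀)
    averaged = begin
      fromℕ K
        ≈⟨ trans (*-congˡ (y-x+x≈y δ 1#)) (*-identityʳ _) ⟨
      fromℕ K * ((1# - δ) + δ)
        ≤⟨ *-monoʳ-≤ _ (fromℕ-nonneg K) (+-monoˡ-≤ δ (complete uniformOracle)) ⟩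
      fromℕ K * ((∑[ r < outcomes ] (p r * U r)) + δ)
        ≈⟨ distribˡ _ _ _ ⟩
      fromℕ K * (∑[ r < outcomes ] (p r * U r)) + fromℕ K * δ
        ≈⟨ +-congʳ (trans (*-distribˡ-sum {outcomes} _ (λ r → p r * U r))
             (sum-cong {outcomes} λ r → solve 3 (λ k p u → k :* (p :* u) := p :* (k :* u)) refl _ _ _)) ⟩
      (∑[ r < outcomes ] (p r * (fromℕ K * U r))) + fromℕ K * δ
        ≤⟨ +-monoˡ-≤ _ (mean-mono coins per-outcome) ⟩
      (∑[ r < outcomes ] (p r * (D r + ρ))) + fromℕ K * δ
        ≈⟨ +-congʳ (trans (mean-+ coins D (λ _ → ρ)) (+-congˡ (mean-const coins ρ))) ⟩
      ((∑[ r < outcomes ] (p r * D r)) + ρ) + fromℕ K * δ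
        ≤⟨ +-monoˡ-≤ _ (+-monoˡ-≤ ρ ∑-D-≤) ⟩
      (fromℕ K * δ + ρ) + fromℕ K * δ
        ≈⟨ solve 2 (λ x ρ → (x :+ ρ) :+ x := x :+ x :+ ρ) refl _ _ ⟩
      fromℕ K * δ + fromℕ K * δ + ρ ∎
      where
      ρ = fromℕ t + fromℕ K * σ₀

    3δ≈1 : fromℕ 3 * δ ≈ 1#
    3δ≈1 = begin-equality
      fromℕ 3 * (fromℕ 1 * (1/ 3))   ≈⟨ *-congˡ (trans (*-congʳ fromℕ-1) (*-identityˡ _)) ⟩
      fromℕ 3 * (1/ 3)               ≈⟨ trans (*-comm _ _) (1/-inverseˡ 3) ⟩
      1#                             ∎

    -- 24 clears the denominators 3 of δ and 8 of σ₀.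
    24K≤19K+24t : 24 ℕ.* K ℕ.≤ (8 ℕ.+ 8 ℕ.+ 3) ℕ.* K ℕ.+ 8 ℕ.* 3 ℕ.* t
    24K≤19K+24t = fromℕ-cancel-≤ (begin
      fromℕ (8 ℕ.* 3 ℕ.* K)
        ≈⟨ trans (fromℕ-* (8 ℕ.* 3) K) (*-congʳ (fromℕ-* 8 3)) ⟩
      e * d * fromℕ K
        ≤⟨ *-monoʳ-≤ (e * d) (0≤x*y (fromℕ-nonneg 8) (fromℕ-nonneg 3)) averaged ⟩
      e * d * (fromℕ K * δ + fromℕ K * δ + (fromℕ t + fromℕ K * σ₀))
        ≈⟨ solve 6 (λ e d K δ t σ → e :* d :* (K :* δ :+ K :* δ :+ (t :+ K :* σ))
                      := (e :+ e) :* K :* (d :* δ) :+ e :* d :* t :+ d :* K :* (e :* σ)) refl e d (fromℕ K) δ (fromℕ t) σ₀ ⟩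
      (e + e) * fromℕ K * (d * δ) + e * d * fromℕ t + d * fromℕ K * (e * σ₀)
        ≤⟨ +-mono-≤ (≤-reflexive (+-congʳ (*-congˡ 3δ≈1)))
             (*-monoʳ-≤ _ (0≤x*y (fromℕ-nonneg 3) (fromℕ-nonneg K)) (8σ≤1 t<q 0)) ⟩
      (e + e) * fromℕ K * 1# + e * d * fromℕ t + d * fromℕ K * 1#
        ≈⟨ solve 4 (λ e d K t → (e :+ e) :* K :* con 1 :+ e :* d :* t :+ d :* K :* con 1
                      := (e :+ e :+ d) :* K :+ e :* d :* t) refl e d (fromℕ K) (fromℕ t) ⟩
      (e + e + d) * fromℕ K + e * d * fromℕ t
        ≈⟨ +-cong (trans (fromℕ-* (8 ℕ.+ 8 ℕ.+ 3) K) (*-congʳ (trans (fromℕ-+ (8 ℕ.+ 8) 3) (+-congʳ (fromℕ-+ 8 8)))))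
                  (trans (fromℕ-* (8 ℕ.* 3) t) (*-congʳ (fromℕ-* 8 3))) ⟨
      fromℕ ((8 ℕ.+ 8 ℕ.+ 3) ℕ.* K) + fromℕ (8 ℕ.* 3 ℕ.* t)
        ≈⟨ fromℕ-+ ((8 ℕ.+ 8 ℕ.+ 3) ℕ.* K) (8 ℕ.* 3 ℕ.* t) ⟨
      fromℕ ((8 ℕ.+ 8 ℕ.+ 3) ℕ.* K ℕ.+ 8 ℕ.* 3 ℕ.* t) ∎)
      where
      e = fromℕ 8
      d = fromℕ 3

    no-tester : ⊥
    no-tester = too-few t<q 24K≤19K+24t

-- Double exponential growth and the theorem

<log₂⇒2^< : ∀ {k n} → k ℕ.< ⌈log₂ n ⌉ → 2 ℕ.^ k ℕ.< n
<log₂⇒2^< {k} {n} k<log = ℕ.≰⇒> λ n≤2^k →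
  ℕ.<⇒≱ k<log (ℕ.≤-trans (⌈log₂⌉-mono-≤ n≤2^k) (ℕ.≤-reflexive (⌈log₂2^n⌉≡n k)))

2^-nonZero : ∀ T → NonZero (2 ℕ.^ T)
2^-nonZero T = ℕ.m^n≢0 2 T

n<2^n : ∀ n → n ℕ.< 2 ℕ.^ n
n<2^n ℕ.zero    = ℕ.s≤s ℕ.z≤n
n<2^n (ℕ.suc n) = begin-strict
  ℕ.suc n                        <⟨ ℕ.s≤s (n<2^n n) ⟩
  ℕ.suc (2 ℕ.^ n)                ≤⟨ ℕ.+-monoˡ-≤ (2 ℕ.^ n) (ℕ.>-nonZero⁻¹ (2 ℕ.^ n) {{2^-nonZero n}}) ⟩
  2 ℕ.^ n ℕ.+ 2 ℕ.^ n            ≡⟨ ≡.cong (2 ℕ.^ n ℕ.+_) (ℕ.+-identityʳ (2 ℕ.^ n)) ⟨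
  2 ℕ.^ ℕ.suc n                  ∎
  where open ℕ.≤-Reasoning

-- The largest scale for q = 2 ^ T.
module _ (T : ℕ) (1≤T : 1 ℕ.≤ T) where

  private
    q = 2 ℕ.^ T
  open Scales q {{2^-nonZero T}}
  open ℕ.≤-Reasoning

  R≡2^ : R ≡ 2 ℕ.^ (12 ℕ.+ T ℕ.* 4)
  R≡2^ = begin-equality
    R                                 ≡⟨ expand q ⟩
    4096 ℕ.* q ℕ.^ 4                  ≡⟨ ≡.cong (4096 ℕ.*_) (ℕ.^-*-assoc 2 T 4) ⟩
    2 ℕ.^ 12 ℕ.* 2 ℕ.^ (T ℕ.* 4)      ≡⟨ ℕ.^-distribˡ-+-* 2 12 (T ℕ.* 4) ⟨
    2 ℕ.^ (12 ℕ.+ T ℕ.* 4)            ∎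
    where
    expand : ∀ q → 32 ℕ.* q ℕ.* (q ℕ.+ q) ℕ.* (32 ℕ.* q ℕ.* (q ℕ.+ q)) ≡
                   4096 ℕ.* (q ℕ.* (q ℕ.* (q ℕ.* (q ℕ.* 1))))
    expand = solve-∀

  2≤q : 2 ℕ.≤ q
  2≤q = ℕ.^-monoʳ-≤ 2 1≤T

  exponent-≤ : 2 ℕ.+ (12 ℕ.+ T ℕ.* 4) ℕ.* (8 ℕ.* q) ℕ.≤ 2 ℕ.^ (T ℕ.* 10)
  exponent-≤ = begin
    2 ℕ.+ (12 ℕ.+ T ℕ.* 4) ℕ.* (8 ℕ.* q)
      ≤⟨ ℕ.+-mono-≤ 2≤2qq (ℕ.*-monoˡ-≤ (8 ℕ.* q) (ℕ.+-mono-≤ 12≤12q (ℕ.*-monoˡ-≤ 4 (ℕ.<⇒≤ (n<2^n T))))) ⟩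
    2 ℕ.* (q ℕ.* q) ℕ.+ (12 ℕ.* q ℕ.+ q ℕ.* 4) ℕ.* (8 ℕ.* q)
      ≡⟨ collect q ⟩
    130 ℕ.* (q ℕ.* q)
      ≤⟨ ℕ.*-monoˡ-≤ (q ℕ.* q) (ℕ.≤-trans (ℕ.m≤m+n 130 126) (ℕ.^-monoˡ-≤ 8 2≤q)) ⟩
    q ℕ.^ 8 ℕ.* (q ℕ.* q)
      ≡⟨ ≡.cong (λ x → q ℕ.^ 8 ℕ.* (q ℕ.* x)) (ℕ.*-identityʳ q) ⟨
    q ℕ.^ 8 ℕ.* q ℕ.^ 2
      ≡⟨ ℕ.^-distribˡ-+-* q 8 2 ⟨
    q ℕ.^ 10
      ≡⟨ ℕ.^-*-assoc 2 T 10 ⟩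
    2 ℕ.^ (T ℕ.* 10) ∎
    where
    1≤q : 1 ℕ.≤ q
    1≤q = ℕ.<⇒≤ 2≤q
    2≤2qq : 2 ℕ.≤ 2 ℕ.* (q ℕ.* q)
    2≤2qq = ℕ.*-monoʳ-≤ 2 (ℕ.*-mono-≤ 1≤q 1≤q)
    12≤12q : 12 ℕ.≤ 12 ℕ.* q
    12≤12q = ℕ.*-monoʳ-≤ 12 1≤q
    collect : ∀ q → 2 ℕ.* (q ℕ.* q) ℕ.+ (12 ℕ.* q ℕ.+ q ℕ.* 4) ℕ.* (8 ℕ.* q) ≡ 130 ℕ.* (q ℕ.* q)
    collect = solve-∀

  largest-scale-≤ : 4 ℕ.* R ℕ.^ (8 ℕ.* q) ℕ.≤ 2 ℕ.^ (2 ℕ.^ (T ℕ.* 10))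
  largest-scale-≤ = begin
    4 ℕ.* R ℕ.^ (8 ℕ.* q)
      ≡⟨ ≡.cong (λ r → 4 ℕ.* r ℕ.^ (8 ℕ.* q)) R≡2^ ⟩
    4 ℕ.* (2 ℕ.^ (12 ℕ.+ T ℕ.* 4)) ℕ.^ (8 ℕ.* q)
      ≡⟨ ≡.cong (4 ℕ.*_) (ℕ.^-*-assoc 2 (12 ℕ.+ T ℕ.* 4) (8 ℕ.* q)) ⟩
    2 ℕ.^ 2 ℕ.* 2 ℕ.^ ((12 ℕ.+ T ℕ.* 4) ℕ.* (8 ℕ.* q))
      ≡⟨ ℕ.^-distribˡ-+-* 2 2 ((12 ℕ.+ T ℕ.* 4) ℕ.* (8 ℕ.* q)) ⟨
    2 ℕ.^ (2 ℕ.+ (12 ℕ.+ T ℕ.* 4) ℕ.* (8 ℕ.* q))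
      ≤⟨ ℕ.^-monoʳ-≤ 2 exponent-≤ ⟩
    2 ℕ.^ (2 ℕ.^ (T ℕ.* 10)) ∎

-- For t = 0 the bound comes from the choice of n₀.
double-exponential-≤ : ∀ t n → 2 ℕ.^ (2 ℕ.^ 10) ℕ.≤ n → t ℕ.* 10 ℕ.< ⌈log₂ ⌈log₂ n ⌉ ⌉ →
                       2 ℕ.^ (2 ℕ.^ ((t ℕ.⊔ 1) ℕ.* 10)) ℕ.≤ n
double-exponential-≤ ℕ.zero        n n₀≤n _  = n₀≤n
double-exponential-≤ t@(ℕ.suc t-1) n _    lt = ≡.subst (λ T → 2 ℕ.^ (2 ℕ.^ (T ℕ.* 10)) ℕ.≤ n)
  (≡.sym (ℕ.m≥n⇒m⊔n≡m {t} (ℕ.s≤s ℕ.z≤n))) (ℕ.<⇒≤ (<log₂⇒2^< (<log₂⇒2^< {t ℕ.* 10} lt)))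

open import Data.Rational.Base using (0ℚ; _<_; _≤_; _*_; *<*; toℚᵘ)

tenth-≤ : ∀ ℓ t → ℓ ℕ.≤ t ℕ.* 10 → (+ 1 / 10) * (+ ℓ / 1) ≤ + t / 1
tenth-≤ ℓ t ℓ≤10t = ℚ.toℚᵘ-cancel-≤ (begin
  toℚᵘ ((+ 1 / 10) * (+ ℓ / 1))              ≃⟨ ℚ.toℚᵘ-homo-* (+ 1 / 10) (+ ℓ / 1) ⟩
  toℚᵘ (+ 1 / 10) ℚᵘ.* toℚᵘ (+ ℓ / 1)        ≃⟨ ℚᵘ.*-congˡ {toℚᵘ (+ 1 / 10)} (ℚ.toℚᵘ-fromℚᵘ (ℚᵘ.mkℚᵘ (+ ℓ) 0)) ⟩
  ℚᵘ.mkℚᵘ (+ 1) 9 ℚᵘ.* ℚᵘ.mkℚᵘ (+ ℓ) 0       ≤⟨ ℚᵘ.*≤* (ℤ.≤-trans (ℤ.≤-reflexive left) (ℤ.≤-trans (ℤ.+≤+ ℓ≤10t) (ℤ.≤-reflexive (ℤ.pos-* t 10)))) ⟩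
  ℚᵘ.mkℚᵘ (+ t) 0                            ≃⟨ ℚ.toℚᵘ-fromℚᵘ (ℚᵘ.mkℚᵘ (+ t) 0) ⟨
  toℚᵘ (+ t / 1)                             ∎)
  where
  open ℚᵘ.≤-Reasoning
  left : (+ 1 ℤ.* + ℓ) ℤ.* + 1 ≡ + ℓ
  left = ≡.trans (ℤ.*-identityʳ _) (ℤ.*-identityˡ (+ ℓ))

theorem7p2p1 :
  ∀ {a ℓ₁ ℓ₂} →
  ∃[ ε ] ∃[ c ] (0ℚ < ε × 0ℚ < c ×
    (∃[ n₀ ] ((n : ℕ) → .{{_ : NonZero n}} → n₀ ℕ.≤ n →
      (𝔽 : OrderedField a ℓ₁ ℓ₂) →
      let open OrderedField 𝔽 using (fromℚ)
          open UniformityTesting 𝔽 in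
      (t : ℕ) (T : NonAdaptiveTester n t) →
      IsUniformityTester (fromℚ ε) (fromℚ (+ 1 / 3)) T →
      c * (+ ⌈log₂ ⌈log₂ n ⌉ ⌉ / 1) ≤ + t / 1)))
-- ε = 1/4 is a lower bound on the distance of the hard instances from uniform,
-- and c = 1/10 matches the exponent in double-exponential-≤.
theorem7p2p1 =
  + 1 / 4 , + 1 / 10 , *<* (ℤ.+<+ (ℕ.s≤s ℕ.z≤n)) , *<* (ℤ.+<+ (ℕ.s≤s ℕ.z≤n)) ,
  2 ℕ.^ (2 ℕ.^ 10) , bound
  where
  bound : ∀ {a ℓ₁ ℓ₂} n → .{{_ : NonZero n}} → 2 ℕ.^ (2 ℕ.^ 10) ℕ.≤ n →
    (𝔽 : OrderedField a ℓ₁ ℓ₂) → let open OrderedField 𝔽 using (fromℚ)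
                                     open UniformityTesting 𝔽 in
    ∀ t (T : NonAdaptiveTester n t) → IsUniformityTester (fromℚ (+ 1 / 4)) (fromℚ (+ 1 / 3)) T →
    (+ 1 / 10) * (+ ⌈log₂ ⌈log₂ n ⌉ ⌉ / 1) ≤ + t / 1
  bound n n₀≤n 𝔽 t T isTester with ⌈log₂ ⌈log₂ n ⌉ ⌉ ℕ.≤? t ℕ.* 10
  ... | yes ℓ≤10t = tenth-≤ ⌈log₂ ⌈log₂ n ⌉ ⌉ t ℓ≤10t
  ... | no  ℓ≰10t = ⊥-elim (Averaging.no-tester 𝔽 n (2 ℕ.^ (t ℕ.⊔ 1)) {{2^-nonZero (t ℕ.⊔ 1)}}
    (ℕ.≤-<-trans (ℕ.m≤m⊔n t 1) (n<2^n (t ℕ.⊔ 1)))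
    (ℕ.≤-trans (largest-scale-≤ (t ℕ.⊔ 1) (ℕ.m≤n⊔m t 1)) (double-exponential-≤ t n n₀≤n (ℕ.≰⇒> ℓ≰10t)))
    T isTester)
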